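{- Let $p\in(0,1)$ be constant. Starting from the unit mass $\delta_o$ at the origin $o$ of the comb graph $\mathbb{C}_2$, the minimum number of toppling moves needed to transport mass $p$ to distance at least $n$ from the origin satisfies $$N_p(\mathbb{C}_2,B_n,\delta_o)=\Theta(n^{7/2}),$$ i.e. there exist constants $0<c\le C<\infty$ and $n_0$, depending only on $p$, such that $c\,n^{7/2}\le N_p(\mathbb{C}_2,B_n,\delta_o)\le C\,n^{7/2}$ for all integers $n\ge n_0$.
   Context: The comb graph $\mathbb{C}_2$ is obtained from the square lattice $\mathbb{Z}^2$ (nearest-neighbour graph) by removing all horizontal edges except those on the $x$-axis; its origin is $o=(0,0)$. Toppling: let $G=(V,E)$ be a connected, locally finite graph, and write $y\sim v$ when $y,v$ are adjacent and $\mathcal{N}_v=\{y:y\sim v\}$. A mass distribution is a function $\mu:V\to[0,\infty)$. For a vertex $v$ with $\mu(v)>0$ and $0<m\le\mu(v)$, the toppling move $T_v^m$ topples mass $m$ at $v$ equally to its neighbours: $T_v^m\mu=\mu-m\delta_v+\frac{m}{|\mathcal{N}_v|}\sum_{y\sim v}\delta_y$. For $A\subset V$, $p>0$ and an initial mass distribution $\mu_0$, $N_p(G,A,\mu_0)$ is the minimum number of successive toppling moves needed to obtain from $\mu_0$ a mass distribution $\mu$ with $\sum_{v\notin A}\mu(v)\ge p$ (and $\infty$ if this is impossible). $B_n=\{u\in V: d_G(u,o)<n\}$ is the open ball of radius $n$ around $o$ in the graph distance $d_G$ (here $G=\mathbb{C}_2$). -}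

module Defs where

open import Algebra.Bundles using (CommutativeRing)
open import Algebra.Structures using (IsCommutativeRing)
import Algebra.Properties.Ring as RingProperties
import Algebra.Properties.Semiring.Exp as Exp
import Algebra.Properties.Semiring.Mult as Mult
open import Axiom.ExcludedMiddle using (ExcludedMiddle)
open import Data.Bool.Base using (if_then_else_)
open import Data.Integer.Base as ℤ using (ℤ; +_; -[1+_]; 0ℤ; 1ℤ; ∣_∣)
import Data.Integer.Properties as ℤ
open import Data.List.Base using (List; []; _∷_; _++_; map; foldr; length)
open import Data.List.Membership.Propositional using (_∈_)
open import Data.List.Membership.Propositional.Properties
  using (∈-++⁺ˡ; ∈-++⁺ʳ; ∈-++⁻; ∈-map⁺; ∈-map⁻)
open import Data.List.Relation.Unary.All using (All; []; _∷_)
open import Data.List.Relation.Unary.AllPairs using ([]; _∷_)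
open import Data.List.Relation.Unary.Any using (here; there)
open import Data.List.Relation.Unary.Unique.Propositional using (Unique)
open import Data.List.Relation.Unary.Unique.Propositional.Properties
  using () renaming (map⁺ to Unique-map⁺; ++⁺ to Unique-++⁺)
open import Data.Nat.Base as ℕ using (ℕ; zero; suc)
import Data.Nat.Properties as ℕ
open import Data.Product.Base using (∃; ∃-syntax; _×_; _,_; proj₁; proj₂)
open import Data.Product.Properties using (≡-dec)
open import Data.Sum.Base using (_⊎_; inj₁; inj₂)
open import Function.Base using (_∘_)
open import Function.Bundles using (_⇔_; mk⇔)
open import Level using (0ℓ)
open import Relation.Binary.Bundles using (DecTotalOrder)
open import Relation.Binary.Core using (Rel)
open import Relation.Binary.Definitions using (DecidableEquality; Symmetric; Irreflexive)
import Relation.Binary.Construct.NonStrictToStrict as ToStrict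
open import Relation.Binary.PropositionalEquality
  using (_≡_; _≢_; refl; sym; trans; cong)
import Relation.Binary.Reasoning.Setoid as ≈-Reasoning
open import Relation.Binary.Structures using (IsDecTotalOrder)
open import Relation.Nullary using (¬_; does; yes; no; contradiction)
open import Relation.Nullary.Construct.Add.Supremum using (_⁺; ⊤⁺; [_])
open import Relation.Unary using (Pred)

------------------------------------------------------------------------
-- Real numbers

-- The library has no real numbers, so they enter through their classical
-- axioms: a complete ordered field, which is unique up to isomorphism.
-- The order is decidable as in classical mathematics, and a supremum is an
-- upper bound that is approximated from below by elements of the set.
-- Together these give excluded middle (see `excludedMiddle` below), so
-- every statement about a structure of this kind is a classical one.

record Reals : Set₁ where
  infix  9 _⁻¹
  infixl 7 _*_
  infixl 6 _+_
  infix  8 -_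
  infix  4 _≈_ _≤_ _<_
  field
    Carrier : Set
    _≈_     : Rel Carrier 0ℓ
    _≤_     : Rel Carrier 0ℓ
    _+_     : Carrier → Carrier → Carrier
    _*_     : Carrier → Carrier → Carrier
    -_      : Carrier → Carrier
    0#      : Carrier
    1#      : Carrier
    _⁻¹     : Carrier → Carrier   -- the value at 0# is arbitrary

    isCommutativeRing : IsCommutativeRing _≈_ _+_ _*_ -_ 0# 1#
    isDecTotalOrder   : IsDecTotalOrder _≈_ _≤_
    0≉1               : ¬ 0# ≈ 1#
    ⁻¹-cong           : ∀ {x y} → x ≈ y → x ⁻¹ ≈ y ⁻¹
    ⁻¹-inverseʳ       : ∀ {x} → ¬ x ≈ 0# → x * x ⁻¹ ≈ 1#
    +-monoʳ-≤         : ∀ x {y z} → y ≤ z → x + y ≤ x + z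
    *-nonNeg          : ∀ {x y} → 0# ≤ x → 0# ≤ y → 0# ≤ x * y

  _<_ : Rel Carrier 0ℓ
  _<_ = ToStrict._<_ _≈_ _≤_

  IsSupremum : Pred Carrier 0ℓ → Carrier → Set
  IsSupremum P s = (∀ x → P x → x ≤ s) × (∀ y → y < s → ∃[ x ] P x × y < x)

  field
    complete : ∀ (P : Pred Carrier 0ℓ) → ∃ P → (∃[ b ] (∀ x → P x → x ≤ b)) →
               ∃ (IsSupremum P)

  commutativeRing : CommutativeRing 0ℓ 0ℓ
  commutativeRing = record { isCommutativeRing = isCommutativeRing }

  decTotalOrder : DecTotalOrder 0ℓ 0ℓ 0ℓ
  decTotalOrder = record { isDecTotalOrder = isDecTotalOrder }

  open CommutativeRing commutativeRing public
    using ( ring; semiring; setoid; _-_; +-cong; +-comm; +-assoc; +-identityˡ; +-identityʳ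
          ; -‿inverseˡ; -‿inverseʳ; -‿cong; *-cong; *-comm; *-assoc
          ; *-identityˡ; *-identityʳ; zeroˡ; zeroʳ; distribˡ; distribʳ)
    renaming (refl to ≈-refl; sym to ≈-sym; trans to ≈-trans)

  open DecTotalOrder decTotalOrder public
    using (_≤?_; ≤-respˡ-≈; ≤-respʳ-≈)
    renaming ( _≟_ to _≈?_; refl to ≤-refl; reflexive to ≤-reflexive; trans to ≤-trans
             ; antisym to ≤-antisym; total to ≤-total)

  infixl 7 _/_
  _/_ : Carrier → Carrier → Carrier
  x / y = x * y ⁻¹

  fromℕ : ℕ → Carrier
  fromℕ n = Mult._×_ semiring n 1#

  open Exp semiring public using (_^_)

  sum : List Carrier → Carrier
  sum = foldr _+_ 0#

  ----------------------------------------------------------------------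
  -- Elementary consequences

  open RingProperties ring using (-‿distribʳ-*; -‿involutive)

  ≤⇒0≤- : ∀ {x y} → x ≤ y → 0# ≤ y - x
  ≤⇒0≤- {x} {y} x≤y =
    ≤-respˡ-≈ (-‿inverseˡ x) (≤-respʳ-≈ (+-comm (- x) y) (+-monoʳ-≤ (- x) x≤y))

  +-nonNeg : ∀ {x y} → 0# ≤ x → 0# ≤ y → 0# ≤ x + y
  +-nonNeg {x} 0≤x 0≤y =
    ≤-trans 0≤x (≤-respˡ-≈ (+-identityʳ x) (+-monoʳ-≤ x 0≤y))

  ≤0⇒0≤- : ∀ {x} → x ≤ 0# → 0# ≤ - x
  ≤0⇒0≤- {x} x≤0 = ≤-respʳ-≈ (+-identityˡ (- x)) (≤⇒0≤- x≤0)

  0≤x*x : ∀ x → 0# ≤ x * x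
  0≤x*x x with ≤-total 0# x
  ... | inj₁ 0≤x = *-nonNeg 0≤x 0≤x
  ... | inj₂ x≤0 = ≤-respʳ-≈ eq (*-nonNeg (≤0⇒0≤- x≤0) (≤0⇒0≤- x≤0))
    where
    open RingProperties ring using (-‿distribˡ-*)
    eq : (- x) * (- x) ≈ x * x
    eq = ≈-trans (≈-sym (-‿distribˡ-* x (- x)))
           (≈-trans (-‿cong (≈-sym (-‿distribʳ-* x x))) (-‿involutive (x * x)))

  0≤1 : 0# ≤ 1#
  0≤1 = ≤-respʳ-≈ (*-identityˡ 1#) (0≤x*x 1#)

  0<1 : 0# < 1#
  0<1 = 0≤1 , 0≉1

  0≤fromℕ : ∀ n → 0# ≤ fromℕ n
  0≤fromℕ zero    = ≤-refl
  0≤fromℕ (suc n) = +-nonNeg 0≤1 (0≤fromℕ n)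

  fromℕ-suc≉0 : ∀ n → ¬ fromℕ (suc n) ≈ 0#
  fromℕ-suc≉0 n eq = 0≉1 (≤-antisym 0≤1 1≤0)
    where
    1≤0 : 1# ≤ 0#
    1≤0 = ≤-respʳ-≈ eq (≤-respˡ-≈ (+-identityʳ 1#) (+-monoʳ-≤ 1# (0≤fromℕ n)))

  ⁻¹-nonNeg : ∀ {x} → 0# ≤ x → ¬ x ≈ 0# → 0# ≤ x ⁻¹
  ⁻¹-nonNeg {x} 0≤x x≉0 = ≤-respʳ-≈ eq (*-nonNeg 0≤x (0≤x*x (x ⁻¹)))
    where
    eq : x * (x ⁻¹ * x ⁻¹) ≈ x ⁻¹
    eq = ≈-trans (≈-sym (*-assoc x (x ⁻¹) (x ⁻¹)))
           (≈-trans (*-cong (⁻¹-inverseʳ x≉0) ≈-refl) (*-identityˡ (x ⁻¹)))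

  ^-nonNeg : ∀ {x} → 0# ≤ x → ∀ n → 0# ≤ x ^ n
  ^-nonNeg 0≤x zero    = 0≤1
  ^-nonNeg 0≤x (suc n) = *-nonNeg 0≤x (^-nonNeg 0≤x n)

  excludedMiddle : ExcludedMiddle 0ℓ
  excludedMiddle {P} with complete Q (0# , inj₁ ≈-refl) (1# , bound)
    where
    Q : Pred Carrier 0ℓ
    Q x = x ≈ 0# ⊎ (x ≈ 1# × P)
    bound : ∀ x → Q x → x ≤ 1#
    bound x (inj₁ x≈0)       = ≤-respˡ-≈ (≈-sym x≈0) 0≤1
    bound x (inj₂ (x≈1 , _)) = ≤-reflexive x≈1
  ... | s , upper , approx with s ≤? 0#
  ... | yes s≤0 = no λ p → 0≉1 (≤-antisym 0≤1 (≤-trans (upper 1# (inj₂ (≈-refl , p))) s≤0))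
  ... | no  s≰0 with approx 0# (ToStrict.≰⇒> _≈_ _≤_ ≈-sym ≤-reflexive ≤-total s≰0)
  ... | x , inj₁ x≈0 , (_ , 0≉x) = contradiction (≈-sym x≈0) 0≉x
  ... | x , inj₂ (_ , p) , _     = yes p

  ----------------------------------------------------------------------
  -- Square roots: √ x = sup { y ∣ y² ≤ x }

  -- y ≤ 1 + x, since otherwise y² ≥ y(1 + x) ≥ y + x > x.
  private
    √-bound : ∀ {x} → 0# ≤ x → ∀ y → y * y ≤ x → y ≤ 1# + x
    √-bound {x} 0≤x y y²≤x with ≤-total y 1#
    ... | inj₁ y≤1 = ≤-trans y≤1 (≤-respˡ-≈ (+-identityʳ 1#) (+-monoʳ-≤ 1# 0≤x))
    ... | inj₂ 1≤y = ≤-trans y≤y² (≤-trans y²≤x (≤-respʳ-≈ (+-comm x 1#)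
                       (≤-respˡ-≈ (+-identityʳ x) (+-monoʳ-≤ x 0≤1))))
      where
      0≤y : 0# ≤ y
      0≤y = ≤-trans 0≤1 1≤y
      open ≈-Reasoning setoid
      eq : y + y * (y - 1#) ≈ y * y
      eq = begin
        y + y * (y - 1#)        ≈⟨ +-cong (*-identityʳ y) ≈-refl ⟨
        y * 1# + y * (y - 1#)   ≈⟨ distribˡ y 1# (y - 1#) ⟨
        y * (1# + (y - 1#))     ≈⟨ *-cong ≈-refl (+-comm 1# (y - 1#)) ⟩
        y * ((y - 1#) + 1#)     ≈⟨ *-cong ≈-refl (+-assoc y (- 1#) 1#) ⟩
        y * (y + (- 1# + 1#))   ≈⟨ *-cong ≈-refl (+-cong ≈-refl (-‿inverseˡ 1#)) ⟩
        y * (y + 0#)            ≈⟨ *-cong ≈-refl (+-identityʳ y) ⟩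
        y * y                   ∎
      y≤y² : y ≤ y * y
      y≤y² = ≤-respʳ-≈ eq (≤-respˡ-≈ (+-identityʳ y)
               (+-monoʳ-≤ y (*-nonNeg 0≤y (≤⇒0≤- 1≤y))))

  √ : ∀ x → 0# ≤ x → Carrier
  √ x 0≤x = proj₁ (complete (λ y → y * y ≤ x)
    (0# , ≤-respˡ-≈ (≈-sym (zeroˡ 0#)) 0≤x)
    (1# + x , √-bound 0≤x))

  infix 9 _^[7/2]
  _^[7/2] : ℕ → Carrier
  n ^[7/2] = √ (fromℕ n ^ 7) (^-nonNeg (0≤fromℕ n) 7)

------------------------------------------------------------------------
-- Minima of sets of natural numbers

-- The minimum of the empty set is ∞ = ⊤⁺.
IsMinimum : Pred ℕ 0ℓ → ℕ ⁺ → Set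
IsMinimum P [ k ] = P k × (∀ j → P j → k ℕ.≤ j)
IsMinimum P ⊤⁺    = ∀ k → ¬ P k

------------------------------------------------------------------------
-- Connected, locally finite graphs

data Walk {V : Set} (_~_ : Rel V 0ℓ) : V → V → ℕ → Set where
  nil  : ∀ {u} → Walk _~_ u u 0
  cons : ∀ {u v w k} → u ~ v → Walk _~_ v w k → Walk _~_ u w (suc k)

record Graph : Set₁ where
  infix 4 _~_
  field
    V             : Set
    _~_           : Rel V 0ℓ
    _≟_           : DecidableEquality V
    ~-sym         : Symmetric _~_
    ~-irrefl      : Irreflexive _≡_ _~_
    neighbours    : V → List V
    nbrs-unique   : ∀ v → Unique (neighbours v)
    ∈-nbrs        : ∀ v y → y ∈ neighbours v ⇔ y ~ v
    connected     : ∀ u v → ∃ (Walk _~_ u v)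

  IsDistance : V → V → ℕ → Set
  IsDistance u v d = IsMinimum (Walk _~_ u v) [ d ]

  -- { u ∣ d(u , o) < n }
  Ball : V → ℕ → Pred V 0ℓ
  Ball o n u = ∃[ d ] IsDistance u o d × d ℕ.< n

------------------------------------------------------------------------
-- Toppling

module Toppling (ℝ : Reals) (G : Graph) where
  open Reals ℝ
  open Graph G

  δ : V → V → Carrier
  δ v u = if does (v ≟ u) then 1# else 0#

  δ-nonNeg : ∀ v u → 0# ≤ δ v u
  δ-nonNeg v u with v ≟ u
  ... | yes _ = 0≤1
  ... | no  _ = ≤-refl

  record MassDistribution : Set where
    constructor _,≥0:_
    field
      mass   : V → Carrier
      nonNeg : ∀ v → 0# ≤ mass v
  open MassDistribution public

  unitMass : V → MassDistribution
  unitMass o = δ o ,≥0: δ-nonNeg o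

  toppled : (V → Carrier) → V → Carrier → V → Carrier
  toppled μ v m u =
    (μ u - m * δ v u)
    + m / fromℕ (length (neighbours v)) * sum (map (λ y → δ y u) (neighbours v))

  private
    sum-δ-nonNeg : ∀ ys u → 0# ≤ sum (map (λ y → δ y u) ys)
    sum-δ-nonNeg []       u = ≤-refl
    sum-δ-nonNeg (y ∷ ys) u = +-nonNeg (δ-nonNeg y u) (sum-δ-nonNeg ys u)

    remain-nonNeg : ∀ (μ : MassDistribution) v m → m ≤ mass μ v →
                    ∀ u → 0# ≤ mass μ u - m * δ v u
    remain-nonNeg μ v m m≤μv u with v ≟ u
    ... | yes refl = ≤⇒0≤- (≤-respˡ-≈ (≈-sym (*-identityʳ m)) m≤μv)
    ... | no  _    = ≤⇒0≤- (≤-respˡ-≈ (≈-sym (zeroʳ m)) (nonNeg μ u))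

    spread-nonNeg : ∀ m → 0# ≤ m → ∀ ys u →
                    0# ≤ m / fromℕ (length ys) * sum (map (λ y → δ y u) ys)
    spread-nonNeg m 0≤m []          u = ≤-reflexive (≈-sym (zeroʳ _))
    spread-nonNeg m 0≤m ys@(_ ∷ zs) u =
      *-nonNeg (*-nonNeg 0≤m (⁻¹-nonNeg (0≤fromℕ (length ys)) (fromℕ-suc≉0 (length zs))))
               (sum-δ-nonNeg ys u)

  toppled-nonNeg : ∀ μ v m → 0# < m → m ≤ mass μ v → ∀ u → 0# ≤ toppled (mass μ) v m u
  toppled-nonNeg μ v m 0<m m≤μv u =
    +-nonNeg (remain-nonNeg μ v m m≤μv u) (spread-nonNeg m (proj₁ 0<m) (neighbours v) u)

  topple : ∀ μ v m → 0# < m → m ≤ mass μ v → MassDistribution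
  topple μ v m 0<m m≤μv = toppled (mass μ) v m ,≥0: toppled-nonNeg μ v m 0<m m≤μv

  -- μ ⟶[ k ] ν : ν is obtained from μ by k successive toppling moves.
  data _⟶[_]_ : MassDistribution → ℕ → MassDistribution → Set where
    done : ∀ {μ} → μ ⟶[ 0 ] μ
    move : ∀ {μ ν k} v m (0<m : 0# < m) (m≤μv : m ≤ mass μ v) →
           topple μ v m 0<m m≤μv ⟶[ k ] ν → μ ⟶[ suc k ] ν

  -- Σ_{v ∉ A} μ(v) ≥ p, where the sum, in [0,∞], is the supremum of the
  -- sums over finite subsets (duplicate-free lists) of the complement of A.
  MassOutside≥ : Pred V 0ℓ → Carrier → MassDistribution → Set
  MassOutside≥ A p μ =
    ∀ q → q < p → ∃[ vs ] Unique vs × All (¬_ ∘ A) vs × q < sum (map (mass μ) vs)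

  -- N_p(G, A, μ₀) = N
  IsN : Carrier → Pred V 0ℓ → MassDistribution → ℕ ⁺ → Set
  IsN p A μ₀ = IsMinimum (λ k → ∃[ μ ] μ₀ ⟶[ k ] μ × MassOutside≥ A p μ)

------------------------------------------------------------------------
-- The comb

private
  sides : ℤ → List ℤ
  sides i = 1ℤ ℤ.+ i ∷ ℤ.-1ℤ ℤ.+ i ∷ []

  cancel : ∀ a i → (a ℤ.+ i) ℤ.- i ≡ a
  cancel a i = trans (ℤ.+-assoc a i (ℤ.- i))
                 (trans (cong (λ t → a ℤ.+ t) (ℤ.+-inverseʳ i)) (ℤ.+-identityʳ a))

  uncancel : ∀ j i → (j ℤ.- i) ℤ.+ i ≡ j
  uncancel j i = trans (ℤ.+-assoc j (ℤ.- i) i)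
                   (trans (cong (λ t → j ℤ.+ t) (ℤ.+-inverseˡ i)) (ℤ.+-identityʳ j))

  abs1 : ∀ d → ∣ d ∣ ≡ 1 → d ≡ 1ℤ ⊎ d ≡ ℤ.-1ℤ
  abs1 (+ 1)    refl = inj₁ refl
  abs1 -[1+ 0 ] refl = inj₂ refl

  sides⁺ : ∀ i j → ∣ j ℤ.- i ∣ ≡ 1 → j ∈ sides i
  sides⁺ i j eq with abs1 (j ℤ.- i) eq
  ... | inj₁ d = here (trans (sym (uncancel j i)) (cong (ℤ._+ i) d))
  ... | inj₂ d = there (here (trans (sym (uncancel j i)) (cong (ℤ._+ i) d)))

  sides⁻ : ∀ i j → j ∈ sides i → ∣ j ℤ.- i ∣ ≡ 1
  sides⁻ i _ (here refl)         = cong ∣_∣ (cancel 1ℤ i)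
  sides⁻ i _ (there (here refl)) = cong ∣_∣ (cancel ℤ.-1ℤ i)

  sides-unique : ∀ i → Unique (sides i)
  sides-unique i = (neq ∷ []) ∷ [] ∷ []
    where
    neq : 1ℤ ℤ.+ i ≢ ℤ.-1ℤ ℤ.+ i
    neq eq with trans (sym (cancel 1ℤ i)) (trans (cong (ℤ._- i) eq) (cancel ℤ.-1ℤ i))
    ... | ()

  i∉sides : ∀ i → ¬ ∣ i ℤ.- i ∣ ≡ 1
  i∉sides i eq with trans (sym (cong ∣_∣ (ℤ.+-inverseʳ i))) eq
  ... | ()

Vertical Horizontal _~ᶜ_ : Rel (ℤ × ℤ) 0ℓ
Vertical   (x , y) (x′ , y′) = x ≡ x′ × ∣ y ℤ.- y′ ∣ ≡ 1
Horizontal (x , y) (x′ , y′) = y ≡ y′ × ∣ x ℤ.- x′ ∣ ≡ 1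
u ~ᶜ v = Vertical u v ⊎ (Horizontal u v × proj₂ u ≡ 0ℤ)

~ᶜ-sym : Symmetric _~ᶜ_
~ᶜ-sym {x , y} {x′ , y′} (inj₁ (refl , d)) = inj₁ (refl , trans (ℤ.∣i-j∣≡∣j-i∣ y′ y) d)
~ᶜ-sym {x , y} {x′ , y′} (inj₂ ((refl , d) , z)) =
  inj₂ ((refl , trans (ℤ.∣i-j∣≡∣j-i∣ x′ x) d) , z)

~ᶜ-irrefl : Irreflexive _≡_ _~ᶜ_
~ᶜ-irrefl {x , y} refl (inj₁ (_ , d))       = i∉sides y d
~ᶜ-irrefl {x , y} refl (inj₂ ((_ , d) , _)) = i∉sides x d

verticalNbrs horizontalNbrs combNbrs : ℤ × ℤ → List (ℤ × ℤ)
verticalNbrs   (x , y)     = (x , 1ℤ ℤ.+ y) ∷ (x , ℤ.-1ℤ ℤ.+ y) ∷ []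
horizontalNbrs (x , + 0)   = (1ℤ ℤ.+ x , + 0) ∷ (ℤ.-1ℤ ℤ.+ x , + 0) ∷ []
horizontalNbrs (x , _)     = []
combNbrs v                 = verticalNbrs v ++ horizontalNbrs v

private
  vert⁻ : ∀ v u → u ∈ verticalNbrs v → Vertical u v
  vert⁻ (x , y) _ (here refl)         = refl , sides⁻ y _ (here refl)
  vert⁻ (x , y) _ (there (here refl)) = refl , sides⁻ y _ (there (here refl))

  vert⁺ : ∀ v u → Vertical u v → u ∈ verticalNbrs v
  vert⁺ (x , y) (x , y′) (refl , d) = ∈-map⁺ (x ,_) (sides⁺ y y′ d)

  horiz⁻ : ∀ v u → u ∈ horizontalNbrs v → Horizontal u v × proj₂ u ≡ 0ℤ
  horiz⁻ (x , + 0) _ (here refl)         = (refl , sides⁻ x _ (here refl)) , refl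
  horiz⁻ (x , + 0) _ (there (here refl)) = (refl , sides⁻ x _ (there (here refl))) , refl

  horiz⁺ : ∀ v u → Horizontal u v → proj₂ u ≡ 0ℤ → u ∈ horizontalNbrs v
  horiz⁺ (x , y) (x′ , y′) (refl , d) refl = ∈-map⁺ (_, + 0) (sides⁺ x x′ d)

  horiz-unique : ∀ v → Unique (horizontalNbrs v)
  horiz-unique (x , + 0)     = Unique-map⁺ (cong proj₁) (sides-unique x)
  horiz-unique (x , + suc _) = []
  horiz-unique (x , -[1+ _ ]) = []

combNbrs-unique : ∀ v → Unique (combNbrs v)
combNbrs-unique v@(x , y) =
  Unique-++⁺ (Unique-map⁺ (cong proj₂) (sides-unique y)) (horiz-unique v) disjoint
  where
  disjoint : ∀ {u} → ¬ (u ∈ verticalNbrs v × u ∈ horizontalNbrs v)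
  disjoint {u} (p , q) with vert⁻ v u p | horiz⁻ v u q
  ... | refl , _ | (_ , d) , _ = i∉sides x d

∈-combNbrs : ∀ v y → y ∈ combNbrs v ⇔ y ~ᶜ v
∈-combNbrs v u = mk⇔ to from
  where
  to : u ∈ combNbrs v → u ~ᶜ v
  to p with ∈-++⁻ (verticalNbrs v) p
  ... | inj₁ q = inj₁ (vert⁻ v u q)
  ... | inj₂ q = inj₂ (horiz⁻ v u q)
  from : u ~ᶜ v → u ∈ combNbrs v
  from (inj₁ a)       = ∈-++⁺ˡ (vert⁺ v u a)
  from (inj₂ (a , z)) = ∈-++⁺ʳ (verticalNbrs v) (horiz⁺ v u a z)

private
  Joined : Rel (ℤ × ℤ) 0ℓ
  Joined u v = ∃ (Walk _~ᶜ_ u v)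

  joined-trans : ∀ {u v w} → Joined u v → Joined v w → Joined u w
  joined-trans (_ , nil)      q = q
  joined-trans (_ , cons e p) q with joined-trans (_ , p) q
  ... | _ , r = _ , cons e r

  joined-sym : ∀ {u v} → Joined u v → Joined v u
  joined-sym (_ , nil) = _ , nil
  joined-sym (_ , cons e p) =
    joined-trans (joined-sym (_ , p)) (_ , cons (~ᶜ-sym e) nil)

  dist-pos : ∀ n → ∣ + suc n ℤ.- + n ∣ ≡ 1
  dist-pos n = cong ∣_∣ (cancel 1ℤ (+ n))

  dist-neg : ∀ n → ∣ -[1+ suc n ] ℤ.- -[1+ n ] ∣ ≡ 1
  dist-neg n = cong ∣_∣ (cancel ℤ.-1ℤ -[1+ n ])

  to-axis : ∀ x y → Joined (x , y) (x , 0ℤ)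
  to-axis x (+ 0)        = _ , nil
  to-axis x (+ suc n)    =
    joined-trans (_ , cons (inj₁ (refl , dist-pos n)) nil) (to-axis x (+ n))
  to-axis x -[1+ 0 ]     = _ , cons (inj₁ (refl , refl)) nil
  to-axis x -[1+ suc n ] =
    joined-trans (_ , cons (inj₁ (refl , dist-neg n)) nil) (to-axis x -[1+ n ])

  along-axis : ∀ x → Joined (x , 0ℤ) (0ℤ , 0ℤ)
  along-axis (+ 0)        = _ , nil
  along-axis (+ suc n)    =
    joined-trans (_ , cons (inj₂ ((refl , dist-pos n) , refl)) nil) (along-axis (+ n))
  along-axis -[1+ 0 ]     = _ , cons (inj₂ ((refl , refl) , refl)) nil
  along-axis -[1+ suc n ] =
    joined-trans (_ , cons (inj₂ ((refl , dist-neg n) , refl)) nil) (along-axis -[1+ n ])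

  to-origin : ∀ u → Joined u (0ℤ , 0ℤ)
  to-origin (x , y) = joined-trans (to-axis x y) (along-axis x)

ℂ₂ : Graph
ℂ₂ = record
  { V           = ℤ × ℤ
  ; _~_         = _~ᶜ_
  ; _≟_         = ≡-dec ℤ._≟_ ℤ._≟_
  ; ~-sym       = ~ᶜ-sym
  ; ~-irrefl    = ~ᶜ-irrefl
  ; neighbours  = combNbrs
  ; nbrs-unique = combNbrs-unique
  ; ∈-nbrs      = ∈-combNbrs
  ; connected   = λ u v → joined-trans (to-origin u) (joined-sym (to-origin v))
  }

o : ℤ × ℤ
o = 0ℤ , 0ℤ

{-# OPTIONS --safe #-}
module Submission where

-- Lower bound.  Follow the part α of the mass that has never left the ball.
-- Toppling mass m raises the integral of x² + y² by exactly m, so Σ mᵢ is at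
-- least of order n².  If g is symmetric, nonnegative, and superharmonic in each
-- variable with Δg(v , ·)(v) ≤ - c, then the energy Σ α(u) α(w) g(u , w) drops by
-- at least c m² under such a toppling.  On the comb there is such a g with
-- g(o , o) / c of order √n, so Σ mᵢ² = O(√n), and by Cauchy–Schwarz the number of
-- moves is at least (Σ mᵢ)² / Σ mᵢ², of order n⁴ / √n.
--
-- Upper bound.  In a box of width of order √n and height n, keep toppling the
-- whole mass of some vertex that carries at least a small multiple θ of the
-- average n^(-3/2).  The integral of x² + y² is O(n²) and grows by θ each time,
-- so this stops after O(n² / θ) moves.  Then little mass is left inside, and the
-- superharmonic function (n + x²)(n - |y|) shows that little mass is stuck at the
-- two ends of the spine, so the rest is at height n.

open import Defs

open import Algebra.Bundles using (CommutativeRing)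
import Algebra.Properties.Ring as RingProperties
import Algebra.Properties.Semiring.Mult as Mult
import Algebra.Solver.Ring as RingSolver
open import Algebra.Solver.Ring.AlmostCommutativeRing
  using (fromCommutativeRing; _-Raw-AlmostCommutative⟶_)
open import Data.Bool.Base using (true; false; if_then_else_)
open import Data.Integer.Base as ℤ using (ℤ; +_; -[1+_]; 0ℤ; 1ℤ; ∣_∣)
import Data.Integer.Properties as ℤ
open import Data.List.Base using (List; []; _∷_; _++_; map; length; filter; cartesianProduct)
import Data.List.Membership.DecPropositional as DecMembership
open import Data.List.Membership.Propositional using (_∈_; _∉_; find; lose)
open import Data.List.Membership.Propositional.Properties
  using (∈-filter⁻; ∈-cartesianProduct⁺; ∈-cartesianProduct⁻)
import Data.List.Properties as List
open import Data.List.Relation.Unary.All as All using (All; []; _∷_)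
open import Data.List.Relation.Unary.All.Properties using (¬Any⇒All¬; All¬⇒¬Any)
open import Data.List.Relation.Unary.AllPairs using ([]; _∷_)
open import Data.List.Relation.Unary.Any using (Any; here; there; any?)
open import Data.List.Relation.Unary.Unique.Propositional using (Unique)
open import Data.List.Relation.Unary.Unique.Propositional.Properties using ()
  renaming ( filter⁺ to Unique-filter⁺; ++⁺ to Unique-++⁺
           ; cartesianProduct⁺ to Unique-cartesianProduct⁺)
open import Data.Maybe.Base using (Maybe; just; nothing)
open import Data.Nat.Base as ℕ using (ℕ; zero; suc; z≤n; s≤s; _∸_)
import Data.Nat.Properties as ℕ
import Data.Nat.Solver as ℕ
open import Data.Product.Base using (∃; ∃-syntax; _×_; _,_; proj₁; proj₂)
open import Data.Sum.Base using (_⊎_; inj₁; inj₂)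
open import Function.Base using (_∘_)
open import Function.Bundles using (Equivalence)
open import Level using (0ℓ)
open import Relation.Binary.PropositionalEquality as ≡ using (_≡_; _≢_; refl)
import Relation.Binary.Reasoning.Setoid as ≈-Reasoning
open import Relation.Nullary
  using (¬_; Dec; yes; no; does; contradiction; _×-dec_; _→-dec_)
open import Relation.Nullary.Construct.Add.Supremum using ([_])
open import Relation.Unary using (Pred; Decidable)
open ℕ.+-*-Solver using ()
  renaming (solve to solveℕ; _:+_ to _⊕_; _:*_ to _⊗_; _:=_ to _⊜_; con to conℕ)

-- Both square roots have one source. A walker on the spine enters a tooth about every second step
-- and then reaches height n with probability of order 1/n. So it makes order n steps on the spine
-- before escaping, spreads over a stretch of order √n and returns to `o` order √n times. This fixes
-- the width of the box, and the size of the Green function of the walk killed at the boundary,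
-- which `g` imitates by an explicit formula. A truncated parabola can replace the true decay along
-- the spine, since only upper bounds on Laplacians enter.
--
-- Mass that has left the ball is forgotten rather than followed: the kernel has the needed signs
-- only inside, and later moves may bring mass back.
--
-- The number √n is replaced by a natural number `K` with 2n ≤ K² ≤ 8n. The estimates then become
-- polynomial inequalities, mostly proved by writing the difference of the two sides as a sum of
-- nonnegative terms; the real root in `_^[7/2]` is met only at the end.

-- Ordered field arithmetic, a ring solver with integer coefficients, square roots

module OrderedField (ℝ : Reals) where
  open Reals ℝ
  open RingProperties ring using (-0#≈0#; -‿involutive; -‿+-comm; -‿distribʳ-*)

  ≡⇒≈ : ∀ {x y} → x ≡ y → x ≈ y
  ≡⇒≈ refl = ≈-refl

  ι : ℤ → Carrier
  ι (+ n)    = fromℕ n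
  ι -[1+ n ] = - fromℕ (suc n)

  fromℕ-+ : ∀ m n → fromℕ (m ℕ.+ n) ≈ fromℕ m + fromℕ n
  fromℕ-+ = Mult.×-homo-+ semiring 1#

  fromℕ-* : ∀ m n → fromℕ (m ℕ.* n) ≈ fromℕ m * fromℕ n
  fromℕ-* = Mult.×1-homo-* semiring

  private
    open ≈-Reasoning setoid

    cancel : ∀ a x y → (a + x) - (a + y) ≈ x - y
    cancel a x y = begin
      (a + x) - (a + y)       ≈⟨ +-cong (+-comm a x) (≈-sym (-‿+-comm a y)) ⟩
      (x + a) + (- a + - y)   ≈⟨ +-assoc x a _ ⟩
      x + (a + (- a + - y))   ≈⟨ +-cong ≈-refl (≈-sym (+-assoc a (- a) (- y))) ⟩
      x + ((a - a) + - y)     ≈⟨ +-cong ≈-refl (+-cong (-‿inverseʳ a) ≈-refl) ⟩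
      x + (0# + - y)          ≈⟨ +-cong ≈-refl (+-identityˡ _) ⟩
      x - y                   ∎

    ι-⊖ : ∀ m n → ι (m ℤ.⊖ n) ≈ fromℕ m - fromℕ n
    ι-⊖ zero zero = ≈-sym (-‿inverseʳ 0#)
    ι-⊖ zero (suc n) = ≈-sym (+-identityˡ _)
    ι-⊖ (suc m) zero = ≈-sym (≈-trans (+-cong ≈-refl -0#≈0#) (+-identityʳ _))
    ι-⊖ (suc m) (suc n) = begin
      ι (suc m ℤ.⊖ suc n)             ≡⟨ ≡.cong ι (ℤ.[1+m]⊖[1+n]≡m⊖n m n) ⟩
      ι (m ℤ.⊖ n)                     ≈⟨ ι-⊖ m n ⟩
      fromℕ m - fromℕ n               ≈⟨ cancel 1# _ _ ⟨
      fromℕ (suc m) - fromℕ (suc n)   ∎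

    ι-neg : ∀ i → ι (ℤ.- i) ≈ - ι i
    ι-neg (+ zero)  = ≈-sym -0#≈0#
    ι-neg (+ suc n) = ≈-refl
    ι-neg -[1+ n ]  = ≈-sym (-‿involutive _)

  ι-+ : ∀ i j → ι (i ℤ.+ j) ≈ ι i + ι j
  ι-+ (+ m)    (+ n)    = fromℕ-+ m n
  ι-+ (+ m)    -[1+ n ] = ι-⊖ m (suc n)
  ι-+ -[1+ m ] (+ n)    = ≈-trans (ι-⊖ n (suc m)) (+-comm _ _)
  ι-+ -[1+ m ] -[1+ n ] = begin
    - fromℕ (suc (suc (m ℕ.+ n)))      ≡⟨ ≡.cong (λ k → - fromℕ (suc k)) (ℕ.+-suc m n) ⟨
    - fromℕ (suc m ℕ.+ suc n)          ≈⟨ -‿cong (fromℕ-+ (suc m) (suc n)) ⟩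
    - (fromℕ (suc m) + fromℕ (suc n))  ≈⟨ -‿+-comm _ _ ⟨
    - fromℕ (suc m) - fromℕ (suc n)    ∎

  private
    ι-*ˡ : ∀ m j → ι (+ m ℤ.* j) ≈ fromℕ m * ι j
    ι-*ˡ m (+ n)    = ≈-trans (≡⇒≈ (≡.cong ι (≡.sym (ℤ.pos-* m n)))) (fromℕ-* m n)
    ι-*ˡ m -[1+ n ] = begin
      ι (+ m ℤ.* -[1+ n ])           ≡⟨ ≡.cong ι (ℤ.neg-distribʳ-* (+ m) (+ suc n)) ⟨
      ι (ℤ.- (+ m ℤ.* + suc n))      ≈⟨ ι-neg (+ m ℤ.* + suc n) ⟩
      - ι (+ m ℤ.* + suc n)          ≡⟨ ≡.cong (λ i → - ι i) (ℤ.pos-* m (suc n)) ⟨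
      - fromℕ (m ℕ.* suc n)          ≈⟨ -‿cong (fromℕ-* m (suc n)) ⟩
      - (fromℕ m * fromℕ (suc n))    ≈⟨ -‿distribʳ-* _ _ ⟩
      fromℕ m * - fromℕ (suc n)      ∎

    ι-* : ∀ i j → ι (i ℤ.* j) ≈ ι i * ι j
    ι-* (+ m)    j = ι-*ˡ m j
    ι-* -[1+ m ] j = begin
      ι (-[1+ m ] ℤ.* j)             ≡⟨ ≡.cong ι (ℤ.neg-distribˡ-* (+ suc m) j) ⟨
      ι (ℤ.- (+ suc m ℤ.* j))        ≈⟨ ι-neg (+ suc m ℤ.* j) ⟩
      - ι (+ suc m ℤ.* j)            ≈⟨ -‿cong (ι-*ˡ (suc m) j) ⟩
      - (fromℕ (suc m) * ι j)        ≈⟨ -‿distribˡ-* _ _ ⟩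
      - fromℕ (suc m) * ι j          ∎
      where open RingProperties ring using (-‿distribˡ-*)

    ι-morphism : CommutativeRing.rawRing ℤ.+-*-commutativeRing
                   -Raw-AlmostCommutative⟶ fromCommutativeRing commutativeRing
    ι-morphism = record
      { ⟦_⟧    = ι
      ; +-homo = ι-+
      ; *-homo = ι-*
      ; -‿homo = ι-neg
      ; 0-homo = ≈-refl
      ; 1-homo = +-identityʳ 1#
      }

    _≟ι_ : ∀ i j → Maybe (ι i ≈ ι j)
    i ≟ι j with i ℤ.≟ j
    ... | yes refl = just ≈-refl
    ... | no  _      = nothing

  open RingSolver _ _ ι-morphism _≟ι_ public
    using (solve; Polynomial; con; _:+_; _:*_; _:-_; :-_; _:=_; _:^_)

  -- `nat 1` evaluates to `1# + 0#`, which is not `1#` by computation. Hence many solver calls below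
  -- take `1#` as a separate variable or are preceded by `+-identityʳ 1#`.
  nat : ∀ {n} → ℕ → Polynomial n
  nat m = con (+ m)

  0≤-⇒≤ : ∀ {x y} → 0# ≤ y - x → x ≤ y
  0≤-⇒≤ {x} {y} 0≤y-x = ≤-respʳ-≈ (solve 2 (λ x y → x :+ (y :- x) := y) ≈-refl x y)
                          (≤-respˡ-≈ (+-identityʳ x) (+-monoʳ-≤ x 0≤y-x))

  ≤-diff : ∀ {x y d} → 0# ≤ d → y - x ≈ d → x ≤ y
  ≤-diff 0≤d eq = 0≤-⇒≤ (≤-respʳ-≈ (≈-sym eq) 0≤d)

  +-mono-≤ : ∀ {w x y z} → w ≤ x → y ≤ z → w + y ≤ x + z
  +-mono-≤ {w} {x} {y} {z} w≤x y≤z = ≤-diff (+-nonNeg (≤⇒0≤- w≤x) (≤⇒0≤- y≤z))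
    (solve 4 (λ w x y z → (x :+ z) :- (w :+ y) := (x :- w) :+ (z :- y)) ≈-refl w x y z)

  *-monoˡ-≤ : ∀ {c x y} → 0# ≤ c → x ≤ y → c * x ≤ c * y
  *-monoˡ-≤ {c} {x} {y} 0≤c x≤y = ≤-diff (*-nonNeg 0≤c (≤⇒0≤- x≤y))
    (solve 3 (λ c x y → c :* y :- c :* x := c :* (y :- x)) ≈-refl c x y)

  *-monoʳ-≤ : ∀ {c x y} → 0# ≤ c → x ≤ y → x * c ≤ y * c
  *-monoʳ-≤ {c} {x} {y} 0≤c x≤y = ≤-diff (*-nonNeg 0≤c (≤⇒0≤- x≤y))
    (solve 3 (λ c x y → y :* c :- x :* c := c :* (y :- x)) ≈-refl c x y)

  *-mono-≤ : ∀ {w x y z} → 0# ≤ w → 0# ≤ z → w ≤ x → y ≤ z → w * y ≤ x * z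
  *-mono-≤ 0≤w 0≤z w≤x y≤z = ≤-trans (*-monoˡ-≤ 0≤w y≤z) (*-monoʳ-≤ 0≤z w≤x)

  neg-mono-≤ : ∀ {x y} → x ≤ y → - y ≤ - x
  neg-mono-≤ {x} {y} x≤y = ≤-diff (≤⇒0≤- x≤y)
    (solve 2 (λ x y → :- x :- :- y := y :- x) ≈-refl x y)

  <⇒≱ : ∀ {x y} → x < y → ¬ y ≤ x
  <⇒≱ (x≤y , x≉y) y≤x = x≉y (≤-antisym x≤y y≤x)

  ≰⇒≥ : ∀ {x y} → ¬ x ≤ y → y ≤ x
  ≰⇒≥ {x} {y} x≰y with ≤-total x y
  ... | inj₁ x≤y = contradiction x≤y x≰y
  ... | inj₂ y≤x = y≤x

  ≰⇒> : ∀ {x y} → ¬ x ≤ y → y < x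
  ≰⇒> x≰y = ≰⇒≥ x≰y , λ y≈x → x≰y (≤-reflexive (≈-sym y≈x))

  <-≤-trans : ∀ {x y z} → x < y → y ≤ z → x < z
  <-≤-trans x<y y≤z = ≤-trans (proj₁ x<y) y≤z ,
    λ x≈z → <⇒≱ x<y (≤-respʳ-≈ (≈-sym x≈z) y≤z)

  0<⇒≉0 : ∀ {x} → 0# < x → ¬ x ≈ 0#
  0<⇒≉0 0<x x≈0 = proj₂ 0<x (≈-sym x≈0)

  ⁻¹-inverseˡ : ∀ {x} → 0# < x → x ⁻¹ * x ≈ 1#
  ⁻¹-inverseˡ 0<x = ≈-trans (*-comm _ _) (⁻¹-inverseʳ (0<⇒≉0 0<x))

  *-cancelˡ-≤ : ∀ {c x y} → 0# < c → c * x ≤ c * y → x ≤ y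
  *-cancelˡ-≤ {c} {x} {y} 0<c cx≤cy = ≤-respˡ-≈ (eq x) (≤-respʳ-≈ (eq y)
    (*-monoˡ-≤ (⁻¹-nonNeg (proj₁ 0<c) (0<⇒≉0 0<c)) cx≤cy))
    where
    eq : ∀ z → c ⁻¹ * (c * z) ≈ z
    eq z = ≈-trans (≈-sym (*-assoc _ _ _))
             (≈-trans (*-cong (⁻¹-inverseˡ 0<c) ≈-refl) (*-identityˡ z))

  *-pos : ∀ {x y} → 0# < x → 0# < y → 0# < x * y
  *-pos {x} {y} 0<x 0<y = *-nonNeg (proj₁ 0<x) (proj₁ 0<y) , λ 0≈xy →
    <⇒≱ 0<y (*-cancelˡ-≤ 0<x (≤-reflexive (≈-trans (≈-sym 0≈xy) (≈-sym (zeroʳ x)))))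

  ⁻¹-pos : ∀ {x} → 0# < x → 0# < x ⁻¹
  ⁻¹-pos {x} 0<x = ⁻¹-nonNeg (proj₁ 0<x) (0<⇒≉0 0<x) , λ 0≈x⁻¹ →
    0≉1 (≈-trans (≈-sym (zeroˡ x)) (≈-trans (*-cong 0≈x⁻¹ ≈-refl) (⁻¹-inverseˡ 0<x)))

  fromℕ-mono-≤ : ∀ {m n} → m ℕ.≤ n → fromℕ m ≤ fromℕ n
  fromℕ-mono-≤ {n = n} ℕ.z≤n = 0≤fromℕ n
  fromℕ-mono-≤ (ℕ.s≤s m≤n)  = +-monoʳ-≤ 1# (fromℕ-mono-≤ m≤n)

  fromℕ-cong : ∀ {m n} → m ≡ n → fromℕ m ≈ fromℕ n
  fromℕ-cong refl = ≈-refl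

  0<fromℕ-suc : ∀ n → 0# < fromℕ (suc n)
  0<fromℕ-suc n = 0≤fromℕ (suc n) , λ eq → fromℕ-suc≉0 n (≈-sym eq)

  0<fromℕ : ∀ {n} → 1 ℕ.≤ n → 0# < fromℕ n
  0<fromℕ {suc n} _ = 0<fromℕ-suc n

  -- Otherwise `x` bounds the natural numbers and they have a supremum s. Some natural number
  -- exceeds s - 1, and its successor exceeds s.
  archimedean : ∀ x → ∃[ n ] x ≤ fromℕ n
  archimedean x with excludedMiddle {∃[ n ] x ≤ fromℕ n}
  ... | yes h = h
  ... | no ¬h with complete (λ y → ∃[ n ] y ≈ fromℕ n) (0# , 0 , ≈-refl)
                     (x , λ { y (n , y≈n) → ≤-respˡ-≈ (≈-sym y≈n) (≰⇒≥ λ x≤n → ¬h (n , x≤n)) })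
  ... | s , upper , approx with approx (s - 1#) s-1<s
    where
    s-1<s : s - 1# < s
    s-1<s = ≤-diff 0≤1 (solve 2 (λ s o → s :- (s :- o) := o) ≈-refl s 1#) , λ eq →
      0≉1 (≈-trans (≈-sym (-‿inverseʳ s)) (≈-trans (+-cong ≈-refl (-‿cong (≈-sym eq)))
        (solve 2 (λ s o → s :- (s :- o) := o) ≈-refl s 1#)))
  ... | y , (n , y≈n) , s-1<y = contradiction (upper (fromℕ (suc n)) (suc n , ≈-refl))
          (<⇒≱ (≤-diff (≤⇒0≤- (proj₁ s-1<y)) eq , λ s≈n → proj₂ s-1<y
            (≈-trans (+-cong s≈n ≈-refl) (≈-trans (solve 2 (λ n o → (o :+ n) :- o := n) ≈-refl _ _) (≈-sym y≈n)))))
    where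
    eq : fromℕ (suc n) - s ≈ y - (s - 1#)
    eq = ≈-trans (solve 3 (λ n s o → (o :+ n) :- s := n :- (s :- o)) ≈-refl (fromℕ n) s 1#)
                 (+-cong (≈-sym y≈n) ≈-refl)

  √-isSupremum : ∀ {x} (0≤x : 0# ≤ x) → IsSupremum (λ y → y * y ≤ x) (√ x 0≤x)
  √-isSupremum 0≤x = proj₂ (complete _ _ _)

  ≤-√ : ∀ {x y} (0≤x : 0# ≤ x) → y * y ≤ x → y ≤ √ x 0≤x
  ≤-√ 0≤x = proj₁ (√-isSupremum 0≤x) _

  -- If the supremum exceeded `y`, some z with z² ≤ x would too; but z² ≤ x ≤ y² ≤ z y, and
  -- cancelling z > 0 gives z ≤ y.
  √-≤ : ∀ {x y} (0≤x : 0# ≤ x) → 0# ≤ y → x ≤ y * y → √ x 0≤x ≤ y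
  √-≤ {x} {y} 0≤x 0≤y x≤y² with √ x 0≤x ≤? y
  ... | yes √x≤y = √x≤y
  ... | no  √x≰y with proj₂ (√-isSupremum 0≤x) y (≰⇒> √x≰y)
  ... | z , z²≤x , y<z = contradiction
          (*-cancelˡ-≤ (≤-trans 0≤y (proj₁ y<z) , 0≉z)
            (≤-trans z²≤x (≤-trans x≤y² (*-monoʳ-≤ 0≤y (proj₁ y<z)))))
          (<⇒≱ y<z)
    where
    0≉z : ¬ 0# ≈ z
    0≉z 0≈z = <⇒≱ y<z (≤-respˡ-≈ 0≈z 0≤y)

-- Sums and averages over lists

module FiniteSums (ℝ : Reals) where
  open Reals ℝ
  open OrderedField ℝ

  module _ {A : Set} where

    Σ[_] : List A → (A → Carrier) → Carrier
    Σ[ xs ] f = sum (map f xs)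

    Σ-cong : ∀ {f g} xs → (∀ {x} → x ∈ xs → f x ≈ g x) → Σ[ xs ] f ≈ Σ[ xs ] g
    Σ-cong []       f≈g = ≈-refl
    Σ-cong (x ∷ xs) f≈g = +-cong (f≈g (here refl)) (Σ-cong xs (f≈g ∘ there))

    Σ-mono-≤ : ∀ {f g} xs → (∀ {x} → x ∈ xs → f x ≤ g x) → Σ[ xs ] f ≤ Σ[ xs ] g
    Σ-mono-≤ []       f≤g = ≤-refl
    Σ-mono-≤ (x ∷ xs) f≤g = +-mono-≤ (f≤g (here refl)) (Σ-mono-≤ xs (f≤g ∘ there))

    Σ-0 : ∀ xs → Σ[ xs ] (λ _ → 0#) ≈ 0#
    Σ-0 []       = ≈-refl
    Σ-0 (x ∷ xs) = ≈-trans (+-identityˡ _) (Σ-0 xs)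

    Σ-nonNeg : ∀ {f} xs → (∀ {x} → x ∈ xs → 0# ≤ f x) → 0# ≤ Σ[ xs ] f
    Σ-nonNeg xs 0≤f = ≤-respˡ-≈ (Σ-0 xs) (Σ-mono-≤ xs 0≤f)

    Σ-nonPos : ∀ {f} xs → (∀ {x} → x ∈ xs → f x ≤ 0#) → Σ[ xs ] f ≤ 0#
    Σ-nonPos xs f≤0 = ≤-respʳ-≈ (Σ-0 xs) (Σ-mono-≤ xs f≤0)

    Σ-+ : ∀ f g xs → Σ[ xs ] (λ x → f x + g x) ≈ Σ[ xs ] f + Σ[ xs ] g
    Σ-+ f g []       = ≈-sym (+-identityˡ 0#)
    Σ-+ f g (x ∷ xs) = ≈-trans (+-cong ≈-refl (Σ-+ f g xs))
      (solve 4 (λ a b c d → (a :+ b) :+ (c :+ d) := (a :+ c) :+ (b :+ d)) ≈-refl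
         (f x) (g x) (Σ[ xs ] f) (Σ[ xs ] g))

    Σ-*ˡ : ∀ c f xs → Σ[ xs ] (λ x → c * f x) ≈ c * Σ[ xs ] f
    Σ-*ˡ c f []       = ≈-sym (zeroʳ c)
    Σ-*ˡ c f (x ∷ xs) = ≈-trans (+-cong ≈-refl (Σ-*ˡ c f xs)) (≈-sym (distribˡ c _ _))

    Σ-const : ∀ c xs → Σ[ xs ] (λ _ → c) ≈ fromℕ (length xs) * c
    Σ-const c []       = ≈-sym (zeroˡ c)
    Σ-const c (x ∷ xs) = ≈-trans (+-cong (≈-sym (*-identityˡ c)) (Σ-const c xs)) (≈-sym (distribʳ c _ _))

    Σ-++ : ∀ f xs ys → Σ[ xs ++ ys ] f ≈ Σ[ xs ] f + Σ[ ys ] f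
    Σ-++ f []       ys = ≈-sym (+-identityˡ _)
    Σ-++ f (x ∷ xs) ys = ≈-trans (+-cong ≈-refl (Σ-++ f xs ys)) (≈-sym (+-assoc _ _ _))

    Σ-≤-term : ∀ {f} xs {x} → (∀ {y} → y ∈ xs → f y ≤ 0#) → x ∈ xs → Σ[ xs ] f ≤ f x
    Σ-≤-term {f} (x ∷ xs) f≤0 (here refl) =
      ≤-respʳ-≈ (+-identityʳ _) (+-monoʳ-≤ (f x) (Σ-nonPos xs (f≤0 ∘ there)))
    Σ-≤-term (x ∷ xs) f≤0 (there x∈xs) =
      ≤-respʳ-≈ (+-identityˡ _) (+-mono-≤ (f≤0 (here refl)) (Σ-≤-term xs (f≤0 ∘ there) x∈xs))

  Σ-comm : ∀ {A B : Set} (f : A → B → Carrier) xs ys →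
           Σ[ xs ] (λ x → Σ[ ys ] (f x)) ≈ Σ[ ys ] (λ y → Σ[ xs ] (λ x → f x y))
  Σ-comm f []       ys = ≈-sym (Σ-0 ys)
  Σ-comm f (x ∷ xs) ys = ≈-trans (+-cong ≈-refl (Σ-comm f xs ys)) (≈-sym (Σ-+ _ _ ys))

  average : ∀ {A : Set} → List A → (A → Carrier) → Carrier
  average xs f = Σ[ xs ] f / fromℕ (length xs)

  -- The inverse of `fromℕ 0` has an arbitrary sign, so the empty list is treated apart: there the
  -- numerator vanishes.
  average-nonPos : ∀ {A : Set} {f : A → Carrier} xs → (∀ {x} → x ∈ xs → f x ≤ 0#) → average xs f ≤ 0#
  average-nonPos []           f≤0 = ≤-reflexive (zeroˡ _)
  average-nonPos xs@(_ ∷ xs′) f≤0 = ≤-respʳ-≈ (zeroˡ _)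
    (*-monoʳ-≤ (⁻¹-nonNeg (0≤fromℕ (length xs)) (fromℕ-suc≉0 (length xs′))) (Σ-nonPos xs f≤0))

-- The graph Laplacian, its pairing with mass, and quadratic energies

module Potentials (ℝ : Reals) (G : Graph) where
  open Reals ℝ
  open OrderedField ℝ
  open FiniteSums ℝ public
  open Graph G
  open Toppling ℝ G
  open ≈-Reasoning setoid

  -- The generator of simple random walk. Toppling is its adjoint, as `⟨toppled⟩` makes precise.
  Δ : (V → Carrier) → V → Carrier
  Δ φ v = average (neighbours v) φ - φ v

  Δ-cong : ∀ {φ ψ} → (∀ u → φ u ≈ ψ u) → ∀ v → Δ φ v ≈ Δ ψ v
  Δ-cong φ≈ψ v = +-cong (*-cong (Σ-cong (neighbours v) (λ {x} _ → φ≈ψ x)) ≈-refl) (-‿cong (φ≈ψ v))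

  Δ-+* : ∀ φ m ψ v → Δ (λ u → φ u + m * ψ u) v ≈ Δ φ v + m * Δ ψ v
  Δ-+* φ m ψ v = begin
    Σ[ ns ] (λ u → φ u + m * ψ u) * d - (φ v + m * ψ v)
      ≈⟨ +-cong (*-cong (≈-trans (Σ-+ _ _ ns) (+-cong ≈-refl (Σ-*ˡ m ψ ns))) ≈-refl) ≈-refl ⟩
    (Σ[ ns ] φ + m * Σ[ ns ] ψ) * d - (φ v + m * ψ v)
      ≈⟨ solve 6 (λ a b m d x y → (a :+ m :* b) :* d :- (x :+ m :* y) :=
           (a :* d :- x) :+ m :* (b :* d :- y)) ≈-refl (Σ[ ns ] φ) (Σ[ ns ] ψ) m d (φ v) (ψ v) ⟩
    Δ φ v + m * Δ ψ v ∎
    where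
    ns = neighbours v
    d = fromℕ (length ns) ⁻¹

  Δ-Σ : ∀ {B : Set} (α : B → Carrier) (k : V → B → Carrier) ys v →
        Δ (λ u → Σ[ ys ] (λ w → α w * k u w)) v ≈ Σ[ ys ] (λ w → α w * Δ (λ u → k u w) v)
  Δ-Σ α k [] v = ≈-trans
    (+-cong (≈-trans (*-cong (Σ-0 (neighbours v)) ≈-refl) (zeroˡ _)) ≈-refl) (-‿inverseʳ 0#)
  Δ-Σ α k (y ∷ ys) v = begin
    Δ (λ u → α y * k u y + Σ[ ys ] (λ w → α w * k u w)) v
      ≈⟨ Δ-cong (λ u → +-comm _ _) v ⟩
    Δ (λ u → Σ[ ys ] (λ w → α w * k u w) + α y * k u y) v
      ≈⟨ Δ-+* _ (α y) (λ u → k u y) v ⟩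
    Δ (λ u → Σ[ ys ] (λ w → α w * k u w)) v + α y * Δ (λ u → k u y) v
      ≈⟨ +-comm _ _ ⟩
    α y * Δ (λ u → k u y) v + Δ (λ u → Σ[ ys ] (λ w → α w * k u w)) v
      ≈⟨ +-cong ≈-refl (Δ-Σ α k ys v) ⟩
    Σ[ y ∷ ys ] (λ w → α w * Δ (λ u → k u w) v) ∎

  δ-≡ : ∀ v → δ v v ≈ 1#
  δ-≡ v with v ≟ v
  ... | yes _  = ≈-refl
  ... | no v≢v = contradiction refl v≢v

  δ-≢ : ∀ {v u} → v ≢ u → δ v u ≈ 0#
  δ-≢ {v} {u} v≢u with v ≟ u
  ... | yes v≡u = contradiction v≡u v≢u
  ... | no _    = ≈-refl

  Σ-δ-∉ : ∀ (φ : V → Carrier) xs {v} → v ∉ xs → Σ[ xs ] (λ u → δ v u * φ u) ≈ 0#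
  Σ-δ-∉ φ xs v∉xs = ≈-trans
    (Σ-cong xs λ x∈xs → ≈-trans (*-cong (δ-≢ λ { refl → v∉xs x∈xs }) ≈-refl) (zeroˡ _))
    (Σ-0 xs)

  Σ-δ-∈ : ∀ (φ : V → Carrier) {xs v} → Unique xs → v ∈ xs → Σ[ xs ] (λ u → δ v u * φ u) ≈ φ v
  Σ-δ-∈ φ {x ∷ xs} (x∉ ∷ _) (here refl) = begin
    δ x x * φ x + Σ[ xs ] (λ u → δ x u * φ u)  ≈⟨ +-cong (*-cong (δ-≡ x) ≈-refl) (Σ-δ-∉ φ xs (All¬⇒¬Any x∉)) ⟩
    1# * φ x + 0#                              ≈⟨ +-identityʳ _ ⟩
    1# * φ x                                   ≈⟨ *-identityˡ _ ⟩
    φ x                                        ∎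
  Σ-δ-∈ φ {x ∷ xs} {v} (x∉ ∷ u) (there v∈xs) = begin
    δ v x * φ x + Σ[ xs ] (λ u → δ v u * φ u)
      ≈⟨ +-cong (*-cong (δ-≢ λ { refl → All.lookup x∉ v∈xs refl }) ≈-refl) (Σ-δ-∈ φ u v∈xs) ⟩
    0# * φ x + φ v
      ≈⟨ +-cong (zeroˡ _) ≈-refl ⟩
    0# + φ v
      ≈⟨ +-identityˡ _ ⟩
    φ v ∎

  module Pairing {L : List V} (unique : Unique L) where

    -- Sums run over the finite window `L`. A toppling at an interior vertex moves mass only within
    -- the window, so pairings over `L` change without a boundary term.
    Interior : V → Set
    Interior v = v ∈ L × All (_∈ L) (neighbours v)

    ⟨_,_⟩ : (V → Carrier) → (V → Carrier) → Carrier
    ⟨ α , φ ⟩ = Σ[ L ] (λ u → α u * φ u)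

    ⟨⟩-+* : ∀ α φ m ψ → ⟨ α , (λ u → φ u + m * ψ u) ⟩ ≈ ⟨ α , φ ⟩ + m * ⟨ α , ψ ⟩
    ⟨⟩-+* α φ m ψ = ≈-trans
      (≈-trans (Σ-cong L λ {x} _ → solve 4 (λ a b m c → a :* (b :+ m :* c) := a :* b :+ m :* (a :* c))
                                    ≈-refl (α x) (φ x) m (ψ x))
               (Σ-+ _ _ L))
      (+-cong ≈-refl (Σ-*ˡ m _ L))

    private
      Σ-Σδ : ∀ (φ : V → Carrier) {ys} → All (_∈ L) ys →
             Σ[ L ] (λ u → Σ[ ys ] (λ y → δ y u) * φ u) ≈ Σ[ ys ] φ
      Σ-Σδ φ {ys} ys⊆L = begin
        Σ[ L ] (λ u → Σ[ ys ] (λ y → δ y u) * φ u)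
          ≈⟨ Σ-cong L (λ {u} _ → ≈-trans (*-comm _ _) (≈-trans (≈-sym (Σ-*ˡ (φ u) (λ y → δ y u) ys))
               (Σ-cong ys λ _ → *-comm _ _))) ⟩
        Σ[ L ] (λ u → Σ[ ys ] (λ y → δ y u * φ u))
          ≈⟨ Σ-comm (λ u y → δ y u * φ u) L ys ⟩
        Σ[ ys ] (λ y → Σ[ L ] (λ u → δ y u * φ u))
          ≈⟨ Σ-cong ys (λ y∈ys → Σ-δ-∈ φ unique (All.lookup ys⊆L y∈ys)) ⟩
        Σ[ ys ] φ ∎

    -- Pairing with `δ y` evaluates at y when y lies in `L`, so the mass removed contributes - φ(v)
    -- and the mass spread the average over the neighbours. Every conserved or monotone quantity
    -- below comes from this identity.
    ⟨toppled⟩ : ∀ {v} → Interior v → ∀ α m φ → ⟨ toppled α v m , φ ⟩ ≈ ⟨ α , φ ⟩ + m * Δ φ v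
    ⟨toppled⟩ {v} (v∈L , ns⊆L) α m φ = begin
      Σ[ L ] (λ u → toppled α v m u * φ u)
        ≈⟨ Σ-cong L (λ {u} _ → solve 6 (λ a m t d s f →
             ((a :- m :* t) :+ m :* d :* s) :* f := a :* f :+ m :* (:- (nat 1) :* (t :* f) :+ d :* (s :* f)))
             ≈-refl (α u) m (δ v u) d (Σ[ ns ] (λ y → δ y u)) (φ u)) ⟩
      Σ[ L ] (λ u → α u * φ u + m * (ι (ℤ.- 1ℤ) * (δ v u * φ u) + d * (Σ[ ns ] (λ y → δ y u) * φ u)))
        ≈⟨ Σ-+ _ _ L ⟩
      ⟨ α , φ ⟩ + Σ[ L ] (λ u → m * (ι (ℤ.- 1ℤ) * (δ v u * φ u) + d * (Σ[ ns ] (λ y → δ y u) * φ u)))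
        ≈⟨ +-cong ≈-refl (≈-trans (Σ-*ˡ m _ L) (*-cong ≈-refl (≈-trans (Σ-+ _ _ L)
             (+-cong (≈-trans (Σ-*ˡ _ _ L) (*-cong ≈-refl (Σ-δ-∈ φ unique v∈L)))
                     (≈-trans (Σ-*ˡ _ _ L) (*-cong ≈-refl (Σ-Σδ φ ns⊆L))))))) ⟩
      ⟨ α , φ ⟩ + m * (ι (ℤ.- 1ℤ) * φ v + d * Σ[ ns ] φ)
        ≈⟨ solve 5 (λ a m f d s → a :+ m :* (con ℤ.-1ℤ :* f :+ d :* s) := a :+ m :* (s :* d :- f))
             ≈-refl ⟨ α , φ ⟩ m (φ v) d (Σ[ ns ] φ) ⟩
      ⟨ α , φ ⟩ + m * Δ φ v ∎
      where
      ns = neighbours v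
      d = fromℕ (length ns) ⁻¹

    module _ (g : V → V → Carrier) (g-sym : ∀ u w → g u w ≈ g w u) where

      energy : (V → Carrier) → Carrier
      energy α = ⟨ α , (λ u → ⟨ α , g u ⟩) ⟩

      -- `⟨toppled⟩` is applied once in each variable. By the symmetry of `g` the two cross terms
      -- coincide, and the second application also acts on the first correction, which gives the
      -- term with two Laplacians.
      energy-toppled : ∀ {v} → Interior v → ∀ α m →
        energy (toppled α v m) ≈
        energy α + m * (⟨ α , (λ u → Δ (g u) v) ⟩ + (⟨ α , (λ u → Δ (g u) v) ⟩ + m * Δ (λ u → Δ (g u) v) v))
      energy-toppled {v} int α m = begin
        ⟨ α′ , (λ u → ⟨ α′ , g u ⟩) ⟩
          ≈⟨ Σ-cong L (λ {u} _ → *-cong ≈-refl (⟨toppled⟩ int α m (g u))) ⟩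
        ⟨ α′ , (λ u → ⟨ α , g u ⟩ + m * ψ u) ⟩
          ≈⟨ ⟨toppled⟩ int α m _ ⟩
        ⟨ α , (λ u → ⟨ α , g u ⟩ + m * ψ u) ⟩ + m * Δ (λ u → ⟨ α , g u ⟩ + m * ψ u) v
          ≈⟨ +-cong (⟨⟩-+* α _ m ψ) (*-cong ≈-refl (Δ-+* _ m ψ v)) ⟩
        (energy α + m * ⟨ α , ψ ⟩) + m * (Δ (λ u → ⟨ α , g u ⟩) v + m * Δ ψ v)
          ≈⟨ +-cong ≈-refl (*-cong ≈-refl (+-cong (≈-trans (Δ-Σ α g L v)
               (Σ-cong L λ {w} _ → *-cong ≈-refl (Δ-cong (λ u → g-sym u w) v))) ≈-refl)) ⟩
        (energy α + m * ⟨ α , ψ ⟩) + m * (⟨ α , ψ ⟩ + m * Δ ψ v)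
          ≈⟨ solve 4 (λ e m p q → (e :+ m :* p) :+ m :* (p :+ m :* q) := e :+ m :* (p :+ (p :+ m :* q)))
               ≈-refl (energy α) m ⟨ α , ψ ⟩ (Δ ψ v) ⟩
        energy α + m * (⟨ α , ψ ⟩ + (⟨ α , ψ ⟩ + m * Δ ψ v)) ∎
        where
        α′ = toppled α v m
        ψ : V → Carrier
        ψ u = Δ (g u) v

      -- The linear term is at most 2 m α(v) ψ(v) ≤ 2 m² ψ(v), of which the quadratic
      -- term m² Δψ(v) ≤ - m² ψ(v) can cancel only one half.
      energy-decrease : ∀ {v} → Interior v → ∀ {α m c} → (∀ u → 0# ≤ α u) → 0# ≤ m → m ≤ α v →
        (∀ {u} → u ∈ L → Δ (g u) v ≤ 0#) → Δ (g v) v ≤ - c →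
        energy (toppled α v m) ≤ energy α - c * (m * m)
      energy-decrease {v} int@(v∈L , ns⊆L) {α} {m} {c} 0≤α 0≤m m≤αv ψ≤0 ψv≤-c =
        ≤-respˡ-≈ (≈-sym (energy-toppled int α m)) (≤-respʳ-≈ eq (+-monoʳ-≤ (energy α) (*-monoˡ-≤ 0≤m
          (≤-trans (+-mono-≤ linear (+-mono-≤ linear (*-monoˡ-≤ 0≤m quadratic)))
            (≤-trans (≤-reflexive (solve 2 (λ m s → m :* s :+ (m :* s :+ m :* (:- s)) := m :* s) ≈-refl m (ψ v)))
              (*-monoˡ-≤ 0≤m ψv≤-c))))))
        where
        ψ : V → Carrier
        ψ u = Δ (g u) v

        linear : ⟨ α , ψ ⟩ ≤ m * ψ v
        linear = ≤-trans
          (Σ-≤-term L (λ {u} u∈L → ≤-respʳ-≈ (zeroʳ (α u)) (*-monoˡ-≤ (0≤α u) (ψ≤0 u∈L))) v∈L)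
          (≤-diff (*-nonNeg (≤⇒0≤- m≤αv) (≤0⇒0≤- (ψ≤0 v∈L)))
            (solve 3 (λ m a s → m :* s :- a :* s := (a :- m) :* (:- s)) ≈-refl m (α v) (ψ v)))

        quadratic : Δ ψ v ≤ - ψ v
        quadratic = ≤-respʳ-≈ (+-identityˡ _) (+-mono-≤
          (average-nonPos (neighbours v) (λ y∈ns → ψ≤0 (All.lookup ns⊆L y∈ns))) ≤-refl)

        eq : energy α + m * (m * - c) ≈ energy α - c * (m * m)
        eq = solve 3 (λ e m c → e :+ m :* (m :* (:- c)) := e :- c :* (m :* m)) ≈-refl (energy α) m c

-- Toppling creates no mass

module Conservation (ℝ : Reals) (G : Graph) where
  open Reals ℝ
  open OrderedField ℝ
  open Potentials ℝ G
  open Graph G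
  open Toppling ℝ G
  open DecMembership _≟_ using (_∈?_)

  Σ-filter : ∀ {P : Pred V 0ℓ} (P? : Decidable P) f xs →
             Σ[ filter P? xs ] f ≈ Σ[ xs ] (λ x → if does (P? x) then f x else 0#)
  Σ-filter P? f [] = ≈-refl
  Σ-filter P? f (x ∷ xs) with does (P? x)
  ... | true  = +-cong ≈-refl (Σ-filter P? f xs)
  ... | false = ≈-trans (Σ-filter P? f xs) (≈-sym (+-identityˡ _))

  -- A toppling may carry mass into or out of a fixed list, so no single list has an invariant sum;
  -- a bound over all duplicate-free lists is preserved, and it fits the lists in `MassOutside≥`.
  TotalMass≤ : Carrier → MassDistribution → Set
  TotalMass≤ b μ = ∀ {vs} → Unique vs → Σ[ vs ] (mass μ) ≤ b

  private
    Σδ-∈ : ∀ {vs v} → Unique vs → v ∈ vs → Σ[ vs ] (δ v) ≈ 1#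
    Σδ-∈ {vs} {v} unique v∈vs = ≈-trans (Σ-cong vs λ _ → ≈-sym (*-identityʳ _)) (Σ-δ-∈ (λ _ → 1#) unique v∈vs)

    Σδ-∉ : ∀ {vs v} → v ∉ vs → Σ[ vs ] (δ v) ≈ 0#
    Σδ-∉ {vs} {v} v∉vs = ≈-trans (Σ-cong vs λ _ → ≈-sym (*-identityʳ _)) (Σ-δ-∉ (λ _ → 1#) vs v∉vs)

    Σδ≤1 : ∀ {vs} → Unique vs → ∀ v → Σ[ vs ] (δ v) ≤ 1#
    Σδ≤1 {vs} unique v with v ∈? vs
    ... | yes v∈vs = ≤-reflexive (Σδ-∈ unique v∈vs)
    ... | no  v∉vs = ≤-respˡ-≈ (≈-sym (Σδ-∉ v∉vs)) 0≤1

    spread≤m : ∀ {vs} → Unique vs → ∀ ys {m} → 0# ≤ m →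
               m / fromℕ (length ys) * Σ[ ys ] (λ y → Σ[ vs ] (δ y)) ≤ m
    spread≤m _ [] 0≤m = ≤-respˡ-≈ (≈-sym (zeroʳ _)) 0≤m
    spread≤m unique ys@(_ ∷ ys′) {m} 0≤m = ≤-trans
      (*-monoˡ-≤ (*-nonNeg 0≤m (⁻¹-nonNeg (0≤fromℕ (length ys)) (fromℕ-suc≉0 (length ys′))))
        (Σ-mono-≤ ys λ {y} _ → Σδ≤1 unique y))
      (≤-reflexive (≈-trans (*-cong ≈-refl (Σ-const 1# ys))
        (≈-trans (solve 4 (λ m d l o → (m :* d) :* (l :* o) := m :* (d :* l) :* o) ≈-refl m _ (fromℕ (length ys)) 1#)
          (≈-trans (*-identityʳ _) (≈-trans (*-cong ≈-refl (⁻¹-inverseˡ (0<fromℕ-suc (length ys′)))) (*-identityʳ m))))))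

    Σ-toppled : ∀ μ v m vs → Σ[ vs ] (toppled μ v m) ≈
                (Σ[ vs ] μ - m * Σ[ vs ] (δ v))
                + m / fromℕ (length (neighbours v)) * Σ[ neighbours v ] (λ y → Σ[ vs ] (δ y))
    Σ-toppled μ v m vs = ≈-trans (Σ-+ _ _ vs) (+-cong
      (≈-trans (Σ-cong vs λ {u} _ → solve 3 (λ a m d → a :- m :* d := a :+ (:- m) :* d) ≈-refl (μ u) m (δ v u))
        (≈-trans (Σ-+ _ _ vs) (≈-trans (+-cong ≈-refl (Σ-*ˡ (- m) (δ v) vs))
          (solve 3 (λ a m d → a :+ (:- m) :* d := a :- m :* d) ≈-refl (Σ[ vs ] μ) m (Σ[ vs ] (δ v))))))
      (≈-trans (Σ-*ˡ _ _ vs) (*-cong ≈-refl (Σ-comm (λ u y → δ y u) vs (neighbours v)))))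

  -- If `v` is in the list, the loss of `m` pays for a gain of at most `m`. Otherwise the old bound
  -- for the longer list `v ∷ vs` leaves room `mass μ v`, which is at least `m`.
  TotalMass≤-topple : ∀ {b} μ v m (0<m : 0# < m) (m≤μv : m ≤ mass μ v) →
                      TotalMass≤ b μ → TotalMass≤ b (topple μ v m 0<m m≤μv)
  TotalMass≤-topple {b} μ v m 0<m m≤μv total {vs} unique with v ∈? vs
  ... | yes v∈vs = ≤-trans
          (≤-respˡ-≈ (≈-sym (Σ-toppled (mass μ) v m vs)) (+-mono-≤
            (≤-reflexive (+-cong ≈-refl (-‿cong (≈-trans (*-cong ≈-refl (Σδ-∈ unique v∈vs)) (*-identityʳ m)))))
            (spread≤m unique (neighbours v) (proj₁ 0<m))))
          (≤-respˡ-≈ (solve 2 (λ s m → s := (s :- m) :+ m) ≈-refl _ m) (total unique))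
  ... | no v∉vs = ≤-trans
          (≤-respˡ-≈ (≈-sym (Σ-toppled (mass μ) v m vs)) (+-mono-≤
            (≤-reflexive (+-cong ≈-refl (-‿cong (≈-trans (*-cong ≈-refl (Σδ-∉ v∉vs)) (zeroʳ m)))))
            (≤-trans (spread≤m unique (neighbours v) (proj₁ 0<m)) m≤μv)))
          (≤-respˡ-≈ (solve 2 (λ s m → m :+ s := (s :- nat 0) :+ m) ≈-refl _ (mass μ v))
            (total (¬Any⇒All¬ vs v∉vs ∷ unique)))

  TotalMass≤-⟶ : ∀ {b μ ν j} → μ ⟶[ j ] ν → TotalMass≤ b μ → TotalMass≤ b ν
  TotalMass≤-⟶ done total = total
  TotalMass≤-⟶ (move {μ} v m 0<m m≤μv steps) total =
    TotalMass≤-⟶ steps (TotalMass≤-topple μ v m 0<m m≤μv total)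

  TotalMass≤-unitMass : ∀ v → TotalMass≤ 1# (unitMass v)
  TotalMass≤-unitMass v unique = Σδ≤1 unique v

-- The lower bound for an abstract potential and kernel

module LowerBound (ℝ : Reals) (G : Graph) where
  open Reals ℝ
  open OrderedField ℝ
  open Potentials ℝ G
  open Conservation ℝ G
  open Graph G
  open Toppling ℝ G

  -- `m′ ≤ m` orders the amounts received by the neighbours but works against the order at `v`
  -- itself, hence the separate hypothesis on the remainders.
  toppled-mono : ∀ {α μ v m′ m} → (∀ u → α u ≤ μ u) → m′ ≤ m → α v - m′ ≤ μ v - m →
                 ∀ u → toppled α v m′ u ≤ toppled μ v m u
  toppled-mono {α} {μ} {v} {m′} {m} α≤μ m′≤m rest u = +-mono-≤ remain (spread (neighbours v))
    where
    remain : α u - m′ * δ v u ≤ μ u - m * δ v u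
    remain with v ≟ u
    ... | yes refl = ≤-respˡ-≈ (+-cong ≈-refl (-‿cong (≈-sym (*-identityʳ m′))))
                         (≤-respʳ-≈ (+-cong ≈-refl (-‿cong (≈-sym (*-identityʳ m)))) rest)
    ... | no _ = +-mono-≤ (α≤μ u) (≤-reflexive (-‿cong (≈-trans (zeroʳ m′) (≈-sym (zeroʳ m)))))

    spread : ∀ ys → m′ / fromℕ (length ys) * Σ[ ys ] (λ y → δ y u) ≤
                    m / fromℕ (length ys) * Σ[ ys ] (λ y → δ y u)
    spread [] = ≤-reflexive (≈-trans (zeroʳ _) (≈-sym (zeroʳ _)))
    spread ys@(_ ∷ ys′) = *-monoʳ-≤ (Σ-nonNeg ys λ {y} _ → δ-nonNeg y u)
      (*-monoʳ-≤ (⁻¹-nonNeg (0≤fromℕ (length ys)) (fromℕ-suc≉0 (length ys′))) m′≤m)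

  toppled-0 : ∀ α v u → toppled α v 0# u ≈ α u
  toppled-0 α v u = solve 4 (λ a t d s → (a :- nat 0 :* t) :+ nat 0 :* d :* s := a)
    ≈-refl (α u) (δ v u) _ (Σ[ neighbours v ] (λ y → δ y u))

  module _ {L : List V} (unique : Unique L) where
    open Pairing unique

    -- `φ` converts escape into toppled mass: it is at most 0# off `A`, so discarding mass there
    -- never lowers the pairing, while toppling `m` inside lowers it by exactly 2 m. The kernel `g`
    -- bounds the sum of the squares of the amounts toppled.
    module _
      {A : Pred V 0ℓ} (A? : Decidable A) (A⊆L : ∀ {v} → A v → Interior v)
      (φ : V → Carrier) {M : Carrier} (0≤M : 0# ≤ M) (φ≤M : ∀ u → φ u ≤ M)
      (φ≤0 : ∀ {u} → ¬ A u → φ u ≤ 0#) (Δφ : ∀ v → Δ φ v ≈ - fromℕ 2)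
      (g : V → V → Carrier) (g-sym : ∀ u w → g u w ≈ g w u)
      (g-nonNeg : ∀ {u w} → u ∈ L → w ∈ L → 0# ≤ g u w)
      {c : Carrier} (0≤c : 0# ≤ c)
      (Δg≤0 : ∀ {u v} → u ∈ L → A v → Δ (g u) v ≤ 0#)
      (Δg≤-c : ∀ {v} → A v → Δ (g v) v ≤ - c)
      {σ : Carrier} (0≤σ : 0# ≤ σ)
      where

      E : (V → Carrier) → Carrier
      E = energy g g-sym

      -- Cauchy–Schwarz enters through 2 σ m - σ² m² ≤ 1, so that Ψ drops by at most c per move.
      Ψ : (V → Carrier) → Carrier
      Ψ α = σ * c * ⟨ α , φ ⟩ - σ * σ * E α

      -- α records the mass that has never left A.
      record Confined (μ : MassDistribution) (α : V → Carrier) : Set where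
        field
          nonNegative : ∀ u → 0# ≤ α u
          below       : ∀ u → α u ≤ mass μ u
          support     : ∀ {u} → ¬ A u → α u ≈ 0#
      open Confined

      restrict : (V → Carrier) → V → Carrier
      restrict β u = if does (A? u) then β u else 0#

      restrict-∉ : ∀ β {u} → ¬ A u → restrict β u ≈ 0#
      restrict-∉ β {u} u∉A with A? u
      ... | yes u∈A = contradiction u∈A u∉A
      ... | no  _   = ≈-refl

      restrict-≤ : ∀ {β} → (∀ u → 0# ≤ β u) → ∀ u → 0# ≤ restrict β u × restrict β u ≤ β u
      restrict-≤ 0≤β u with A? u
      ... | yes _ = 0≤β u , ≤-refl
      ... | no  _ = ≤-refl , 0≤β u

      restrict-φ : ∀ {β} → (∀ u → 0# ≤ β u) → ∀ u → β u * φ u ≤ restrict β u * φ u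
      restrict-φ {β} 0≤β u with A? u
      ... | yes _   = ≤-refl
      ... | no  u∉A = ≤-respʳ-≈ (≈-trans (zeroʳ (β u)) (≈-sym (zeroˡ (φ u)))) (*-monoˡ-≤ (0≤β u) (φ≤0 u∉A))

      E-mono : ∀ {α β} → (∀ u → 0# ≤ α u) → (∀ u → α u ≤ β u) → E α ≤ E β
      E-mono {α} {β} 0≤α α≤β = Σ-mono-≤ L λ {u} u∈L → *-mono-≤ (0≤α u)
        (Σ-nonNeg L λ {w} w∈L → *-nonNeg (≤-trans (0≤α w) (α≤β w)) (g-nonNeg u∈L w∈L))
        (α≤β u)
        (Σ-mono-≤ L λ {w} w∈L → *-monoʳ-≤ (g-nonNeg u∈L w∈L) (α≤β w))

      E-nonNeg : ∀ {α} → (∀ u → 0# ≤ α u) → 0# ≤ E α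
      E-nonNeg 0≤α = Σ-nonNeg L λ {u} u∈L → *-nonNeg (0≤α u)
        (Σ-nonNeg L λ {w} w∈L → *-nonNeg (0≤α w) (g-nonNeg u∈L w∈L))

      -- The discarded mass sits where `φ` is at most 0# and has nonnegative interaction energy, so
      -- the linear part rises and the energy falls.
      Ψ-restrict : ∀ {β} → (∀ u → 0# ≤ β u) → Ψ β ≤ Ψ (restrict β)
      Ψ-restrict 0≤β = +-mono-≤
        (*-monoˡ-≤ (*-nonNeg 0≤σ 0≤c) (Σ-mono-≤ L λ {u} _ → restrict-φ 0≤β u))
        (neg-mono-≤ (*-monoˡ-≤ (*-nonNeg 0≤σ 0≤σ)
          (E-mono (λ u → proj₁ (restrict-≤ 0≤β u)) (λ u → proj₂ (restrict-≤ 0≤β u)))))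

      Ψ-toppled : ∀ {v α m} → A v → (∀ u → 0# ≤ α u) → 0# ≤ m → m ≤ α v → Ψ α - c ≤ Ψ (toppled α v m)
      Ψ-toppled {v} {α} {m} v∈A 0≤α 0≤m m≤αv = ≤-trans
        (≤-diff (*-nonNeg 0≤c (0≤x*x (σ * m - fromℕ 1)))
          (solve 5 (λ σ c p m e →
            (σ :* c :* (p :+ m :* :- nat 2) :- σ :* σ :* (e :- c :* (m :* m)))
              :- (σ :* c :* p :- σ :* σ :* e :- c)
            := c :* ((σ :* m :- nat 1) :* (σ :* m :- nat 1)))
            ≈-refl σ c ⟨ α , φ ⟩ m (E α)))
        (+-mono-≤ (*-monoˡ-≤ (*-nonNeg 0≤σ 0≤c) (≤-reflexive (≈-sym (≈-trans (⟨toppled⟩ (A⊆L v∈A) α m φ)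
                     (+-cong ≈-refl (*-cong ≈-refl (Δφ v)))))))
          (neg-mono-≤ (*-monoˡ-≤ (*-nonNeg 0≤σ 0≤σ)
            (energy-decrease g g-sym (A⊆L v∈A) 0≤α 0≤m m≤αv (λ u∈L → Δg≤0 u∈L v∈A) (Δg≤-c v∈A)))))

      -- Inside `A` the confined part topples the smaller of `m` and `α v`. With either choice what
      -- remains of `α` at `v` is at most what remains of `μ`: the full `m` is taken from both, or
      -- nothing of `α` is left. Outside `A` the confined part is zero at `v` and stays unchanged.
      Confined-topple : ∀ {μ α} → Confined μ α → ∀ v m 0<m m≤μv →
                        ∃[ β ] Confined (topple μ v m 0<m m≤μv) β × Ψ α - c ≤ Ψ β
      Confined-topple {μ} {α} conf v m 0<m m≤μv with A? v
      ... | no v∉A = α ,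
            record { nonNegative = nonNegative conf
                   ; below = λ u → ≤-respˡ-≈ (toppled-0 α v u) (toppled-mono (below conf) (proj₁ 0<m)
                       (≤-respˡ-≈ (≈-sym (≈-trans (+-cong (support conf v∉A) ≈-refl) (-‿inverseʳ 0#))) (≤⇒0≤- m≤μv)) u)
                   ; support = support conf } ,
            ≤-diff 0≤c (solve 2 (λ p c → p :- (p :- c) := c) ≈-refl (Ψ α) c)
      ... | yes v∈A = restrict (toppled α v m′) ,
            record { nonNegative = λ u → proj₁ (restrict-≤ 0≤toppled u)
                   ; below = λ u → ≤-trans (proj₂ (restrict-≤ 0≤toppled u))
                       (toppled-mono (below conf) m′≤m rest u)
                   ; support = restrict-∉ (toppled α v m′) } ,
            ≤-trans (Ψ-toppled v∈A (nonNegative conf) 0≤m′ m′≤αv) (Ψ-restrict 0≤toppled)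
        where
        min : ∃[ m′ ] 0# ≤ m′ × m′ ≤ m × m′ ≤ α v × α v - m′ ≤ mass μ v - m
        min with ≤-total m (α v)
        ... | inj₁ m≤αv = m , proj₁ 0<m , ≤-refl , m≤αv , +-mono-≤ (below conf v) ≤-refl
        ... | inj₂ αv≤m = α v , nonNegative conf v , αv≤m , ≤-refl ,
                          ≤-respˡ-≈ (≈-sym (-‿inverseʳ (α v))) (≤⇒0≤- m≤μv)
        m′ = proj₁ min
        0≤m′ = proj₁ (proj₂ min)
        m′≤m = proj₁ (proj₂ (proj₂ min))
        m′≤αv = proj₁ (proj₂ (proj₂ (proj₂ min)))
        rest = proj₂ (proj₂ (proj₂ (proj₂ min)))
        0≤toppled : ∀ u → 0# ≤ toppled α v m′ u
        0≤toppled u = ≤-respˡ-≈ (toppled-0 (λ _ → 0#) v u)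
          (toppled-mono (nonNegative conf) 0≤m′ (≤-respˡ-≈ (≈-sym (-‿inverseʳ 0#)) (≤⇒0≤- m′≤αv)) u)

      Confined-⟶ : ∀ {μ ν α j} → μ ⟶[ j ] ν → Confined μ α →
                   ∃[ β ] Confined ν β × Ψ α - fromℕ j * c ≤ Ψ β
      Confined-⟶ {α = α} done conf = α , conf ,
        ≤-reflexive (solve 2 (λ p c → p :- nat 0 :* c := p) ≈-refl (Ψ α) c)
      Confined-⟶ {α = α} {j = suc j} (move v m 0<m m≤μv steps) conf with Confined-topple conf v m 0<m m≤μv
      ... | β , conf′ , Ψα≤Ψβ with Confined-⟶ steps conf′
      ... | γ , conf″ , Ψβ≤Ψγ = γ , conf″ , ≤-trans
        (≤-respˡ-≈ (≈-trans (solve 4 (λ p c j o → (p :- c) :+ (:- (j :* c)) := p :- (nat 1 :+ j) :* c) ≈-refl (Ψ α) c (fromℕ j) 1#)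
                     (+-cong ≈-refl (-‿cong (*-cong (+-cong (+-identityʳ 1#) ≈-refl) ≈-refl))))
          (+-mono-≤ Ψα≤Ψβ ≤-refl)) Ψβ≤Ψγ

      -- The energy only lowers `Ψ` and `φ` is at most `M`, so the confined mass decides. It lives
      -- on `A`, which is disjoint from `vs`, and the mass on both together is at most 1#.
      Ψ-final : ∀ {ν α q vs} → TotalMass≤ 1# ν → Confined ν α → Unique vs → All (¬_ ∘ A) vs →
                q ≤ Σ[ vs ] (mass ν) → Ψ α ≤ σ * c * (M * (1# - q))
      Ψ-final {ν} {α} {q} {vs} total conf unique-vs vs∉A q≤Σ = ≤-trans
        (+-mono-≤ ≤-refl (neg-mono-≤ (*-nonNeg (*-nonNeg 0≤σ 0≤σ) (E-nonNeg (nonNegative conf)))))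
        (≤-respˡ-≈ (solve 1 (λ x → x := x :- nat 0) ≈-refl _)
          (*-monoˡ-≤ (*-nonNeg 0≤σ 0≤c) (≤-trans
            (Σ-mono-≤ L λ {u} _ → ≤-respʳ-≈ (*-comm _ _) (*-monoˡ-≤ (nonNegative conf u) (φ≤M u)))
            (≤-respˡ-≈ (≈-sym (Σ-*ˡ M α L)) (*-monoˡ-≤ 0≤M inside)))))
        where
        inA = filter A? L

        α≤restrict : ∀ u → α u ≤ restrict (mass ν) u
        α≤restrict u with A? u
        ... | yes _   = below conf u
        ... | no  u∉A = ≤-reflexive (support conf u∉A)

        inside : Σ[ L ] α ≤ 1# - q
        inside = ≤-trans (≤-respʳ-≈ (≈-sym (Σ-filter A? (mass ν) L)) (Σ-mono-≤ L λ {u} _ → α≤restrict u))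
          (≤-diff (+-nonNeg (≤⇒0≤- (total {inA ++ vs} (Unique-++⁺ (Unique-filter⁺ A? unique) unique-vs
                      λ { (x∈A , x∈vs) → All.lookup vs∉A x∈vs (proj₂ (∈-filter⁻ A? {xs = L} x∈A)) })))
                    (≤⇒0≤- q≤Σ))
            (≈-trans (solve 4 (λ o q a b → (o :- q) :- a := (o :- (a :+ b)) :+ (b :- q)) ≈-refl 1# q (Σ[ inA ] (mass ν)) (Σ[ vs ] (mass ν)))
              (+-cong (+-cong ≈-refl (-‿cong (≈-sym (Σ-++ (mass ν) inA vs)))) ≈-refl)))

      topplings≥ : ∀ v {ν j q vs} → A v → unitMass v ⟶[ j ] ν → Unique vs → All (¬_ ∘ A) vs →
                   q ≤ Σ[ vs ] (mass ν) →
                   σ * c * φ v - σ * σ * g v v - fromℕ j * c ≤ σ * c * (M * (1# - q))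
      topplings≥ v v∈A steps unique-vs vs∉A q≤Σ with Confined-⟶ steps start
        where
        start : Confined (unitMass v) (δ v)
        start = record
          { nonNegative = δ-nonNeg v
          ; below       = λ _ → ≤-refl
          ; support     = λ u∉A → δ-≢ λ { refl → u∉A v∈A }
          }
      ... | α , conf , Ψδ≤Ψα = ≤-trans (≤-respˡ-≈ (+-cong (+-cong
              (*-cong ≈-refl (Σ-δ-∈ φ unique v∈L))
              (-‿cong (*-cong ≈-refl (≈-trans (Σ-δ-∈ (λ u → ⟨ δ v , g u ⟩) unique v∈L) (Σ-δ-∈ (g v) unique v∈L))))) ≈-refl) Ψδ≤Ψα)
            (Ψ-final (TotalMass≤-⟶ steps (TotalMass≤-unitMass v)) conf unique-vs vs∉A q≤Σ)
        where
        v∈L = proj₁ (A⊆L v∈A)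

-- Boxes, distances in the comb, and integer square roots

interval : ℕ → List ℤ
interval zero    = 0ℤ ∷ []
interval (suc n) = + suc n ∷ -[1+ n ] ∷ interval n

∈-interval⁻ : ∀ n {z} → z ∈ interval n → ∣ z ∣ ℕ.≤ n
∈-interval⁻ zero    (here refl)         = z≤n
∈-interval⁻ (suc n) (here refl)         = ℕ.≤-refl
∈-interval⁻ (suc n) (there (here refl)) = ℕ.≤-refl
∈-interval⁻ (suc n) (there (there z∈))  = ℕ.m≤n⇒m≤1+n (∈-interval⁻ n z∈)

∈-interval⁺ : ∀ n z → ∣ z ∣ ℕ.≤ n → z ∈ interval n
∈-interval⁺ zero (+ 0) _ = here refl
∈-interval⁺ (suc n) z ∣z∣≤1+n with ℕ.m≤n⇒m<n∨m≡n ∣z∣≤1+n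
... | inj₁ (s≤s ∣z∣≤n) = there (there (∈-interval⁺ n z ∣z∣≤n))
∈-interval⁺ (suc n) (+ _)    _ | inj₂ refl = here refl
∈-interval⁺ (suc n) -[1+ _ ] _ | inj₂ refl = there (here refl)

interval-unique : ∀ n → Unique (interval n)
interval-unique zero    = [] ∷ []
interval-unique (suc n) =
  ((λ ()) ∷ ¬Any⇒All¬ _ (ℕ.1+n≰n ∘ ∈-interval⁻ n)) ∷ ¬Any⇒All¬ _ (ℕ.1+n≰n ∘ ∈-interval⁻ n) ∷ interval-unique n

length-interval : ∀ n → length (interval n) ≡ 1 ℕ.+ 2 ℕ.* n
length-interval zero    = refl
length-interval (suc n) = ≡.trans (≡.cong (2 ℕ.+_) (length-interval n))
  (solveℕ 1 (λ n → conℕ 3 ⊕ conℕ 2 ⊗ n ⊜ conℕ 1 ⊕ conℕ 2 ⊗ (conℕ 1 ⊕ n)) refl n)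

length-cartesianProduct : ∀ {A B : Set} (xs : List A) (ys : List B) →
                          length (cartesianProduct xs ys) ≡ length xs ℕ.* length ys
length-cartesianProduct []       ys = refl
length-cartesianProduct (x ∷ xs) ys = ≡.trans (List.length-++ (map (x ,_) ys))
  (≡.cong₂ ℕ._+_ (List.length-map (x ,_) ys) (length-cartesianProduct xs ys))

box : ℕ → ℕ → List (ℤ × ℤ)
box X Y = cartesianProduct (interval X) (interval Y)

box-unique : ∀ X Y → Unique (box X Y)
box-unique X Y = Unique-cartesianProduct⁺ (interval-unique X) (interval-unique Y)

∈-box⁺ : ∀ {X Y x y} → ∣ x ∣ ℕ.≤ X → ∣ y ∣ ℕ.≤ Y → (x , y) ∈ box X Y
∈-box⁺ {X} {Y} {x} {y} ∣x∣≤X ∣y∣≤Y = ∈-cartesianProduct⁺ (∈-interval⁺ X x ∣x∣≤X) (∈-interval⁺ Y y ∣y∣≤Y)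

∈-box⁻ : ∀ X Y {x y} → (x , y) ∈ box X Y → ∣ x ∣ ℕ.≤ X × ∣ y ∣ ℕ.≤ Y
∈-box⁻ X Y v∈ with ∈-cartesianProduct⁻ (interval X) (interval Y) v∈
... | x∈ , y∈ = ∈-interval⁻ X x∈ , ∈-interval⁻ Y y∈

∣∣-step : ∀ i j → ∣ i ℤ.- j ∣ ≡ 1 → ∣ i ∣ ℕ.≤ suc ∣ j ∣
∣∣-step i j eq = ≡.subst (λ k → ∣ k ∣ ℕ.≤ suc ∣ j ∣) i-j+j≡i
  (≡.subst (λ d → ∣ (i ℤ.- j) ℤ.+ j ∣ ℕ.≤ d ℕ.+ ∣ j ∣) eq (ℤ.∣i+j∣≤∣i∣+∣j∣ (i ℤ.- j) j))
  where
  i-j+j≡i : (i ℤ.- j) ℤ.+ j ≡ i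
  i-j+j≡i = ≡.trans (ℤ.+-assoc i (ℤ.- j) j) (≡.trans (≡.cong (λ k → i ℤ.+ k) (ℤ.+-inverseˡ j)) (ℤ.+-identityʳ i))

∣∣-neighbour : ∀ j {i} e → ∣ e ∣ ≡ 1 → e ℤ.+ j ≡ i → ∣ i ∣ ℕ.≤ suc ∣ j ∣
∣∣-neighbour j e eq refl = ≡.subst (λ d → ∣ e ℤ.+ j ∣ ℕ.≤ d ℕ.+ ∣ j ∣) eq (ℤ.∣i+j∣≤∣i∣+∣j∣ e j)

-- This is the comb distance to `o`: an edge changes it by at most one (`norm-step`), and the walk
-- down the tooth and then along the spine attains it (`walk-to-origin`).
norm : ℤ × ℤ → ℕ
norm (x , y) = ∣ x ∣ ℕ.+ ∣ y ∣

norm-step : ∀ {u v} → u ~ᶜ v → norm u ℕ.≤ suc (norm v)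
norm-step {x , y} {.x , y′} (inj₁ (refl , d)) =
  ℕ.≤-trans (ℕ.+-monoʳ-≤ ∣ x ∣ (∣∣-step y y′ d)) (ℕ.≤-reflexive (ℕ.+-suc ∣ x ∣ ∣ y′ ∣))
norm-step {x , y} {x′ , .y} (inj₂ ((refl , d) , _)) = ℕ.+-monoˡ-≤ ∣ y ∣ (∣∣-step x x′ d)

norm-walk : ∀ {u k} → Walk _~ᶜ_ u o k → norm u ℕ.≤ k
norm-walk nil        = z≤n
norm-walk (cons e w) = ℕ.≤-trans (norm-step e) (s≤s (norm-walk w))

private
  1+n-n : ∀ n → ∣ + suc n ℤ.- + n ∣ ≡ 1
  1+n-n n = ≡.cong ∣_∣ (≡.trans (ℤ.+-assoc 1ℤ (+ n) (ℤ.- + n)) (≡.cong (λ t → 1ℤ ℤ.+ t) (ℤ.+-inverseʳ (+ n))))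

  -1-n+n : ∀ n → ∣ -[1+ suc n ] ℤ.- -[1+ n ] ∣ ≡ 1
  -1-n+n n = ≡.trans (≡.cong ∣_∣ (ℤ.[1+m]⊖[1+n]≡m⊖n n (suc n))) (≡.trans (ℤ.∣m⊖n∣≡∣n⊖m∣ n (suc n)) (≡.trans (≡.cong ∣_∣ (≡.sym (ℤ.m-n≡m⊖n (suc n) n))) (1+n-n n)))

walk-to-origin : ∀ x y → Walk _~ᶜ_ (x , y) o (∣ x ∣ ℕ.+ ∣ y ∣)
walk-to-origin x y = ≡.subst (Walk _~ᶜ_ (x , y) o) (ℕ.+-comm ∣ y ∣ ∣ x ∣) (vertical y)
  where
  horizontal : ∀ x → Walk _~ᶜ_ (x , 0ℤ) o ∣ x ∣
  horizontal (+ zero)      = nil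
  horizontal (+ suc n)     = cons (inj₂ ((refl , 1+n-n n) , refl)) (horizontal (+ n))
  horizontal -[1+ zero ]   = cons (inj₂ ((refl , refl) , refl)) nil
  horizontal -[1+ suc n ]  = cons (inj₂ ((refl , -1-n+n n) , refl)) (horizontal -[1+ n ])

  vertical : ∀ y → Walk _~ᶜ_ (x , y) o (∣ y ∣ ℕ.+ ∣ x ∣)
  vertical (+ zero)      = horizontal x
  vertical (+ suc n)     = cons (inj₁ (refl , 1+n-n n)) (vertical (+ n))
  vertical -[1+ zero ]   = cons (inj₁ (refl , refl)) (horizontal x)
  vertical -[1+ suc n ]  = cons (inj₁ (refl , -1-n+n n)) (vertical -[1+ n ])

∈Ball : ∀ {n} v → norm v ℕ.< n → Graph.Ball ℂ₂ o n v
∈Ball (x , y) lt = _ , (walk-to-origin x y , λ j w → norm-walk w) , lt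

Ball⇒norm< : ∀ {n} v → Graph.Ball ℂ₂ o n v → norm v ℕ.< n
Ball⇒norm< v (d , (w , _) , d<n) = ℕ.≤-<-trans (norm-walk w) d<n

-- K is one more than the integer square root of m + 1.
sqrt-approx : ∀ m → ∃[ K ] suc m ℕ.≤ K ℕ.* K × K ℕ.* K ℕ.≤ 4 ℕ.* suc m
sqrt-approx m with floor m
  where
  floor : ∀ m → ∃[ j ] suc j ℕ.* suc j ℕ.≤ suc m × suc m ℕ.< suc (suc j) ℕ.* suc (suc j)
  floor zero = 0 , ℕ.≤-refl , s≤s (s≤s z≤n)
  floor (suc m) with floor m
  ... | j , lo , hi with suc (suc m) ℕ.<? suc (suc j) ℕ.* suc (suc j)
  ... | yes lt = j , ℕ.m≤n⇒m≤1+n lo , lt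
  ... | no ¬lt = suc j , ℕ.≮⇒≥ ¬lt , ℕ.≤-<-trans hi
                   (ℕ.*-mono-< (ℕ.n<1+n (suc (suc j))) (ℕ.n<1+n (suc (suc j))))
... | j , lo , hi = suc (suc j) , ℕ.<⇒≤ hi , ℕ.≤-trans
        (ℕ.≤-trans (ℕ.*-mono-≤ 2+j≤ 2+j≤)
          (ℕ.≤-reflexive (solveℕ 1 (λ j → (conℕ 2 ⊗ j) ⊗ (conℕ 2 ⊗ j) ⊜ conℕ 4 ⊗ (j ⊗ j)) refl (suc j))))
        (ℕ.*-monoʳ-≤ 4 lo)
  where
  2+j≤ : suc (suc j) ℕ.≤ 2 ℕ.* suc j
  2+j≤ = s≤s (ℕ.≤-trans (ℕ.m≤n+m (suc j) j) (ℕ.≤-reflexive (≡.cong (j ℕ.+_) (≡.sym (ℕ.+-identityʳ (suc j))))))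

-- The Laplacian on teeth and spine

module CombLaplacian (ℝ : Reals) where
  open Reals ℝ
  open OrderedField ℝ
  open Potentials ℝ ℂ₂

  *-cancelˡ-≈ : ∀ {c x y} → 0# < c → c * x ≈ c * y → x ≈ y
  *-cancelˡ-≈ 0<c eq = ≤-antisym (*-cancelˡ-≤ 0<c (≤-reflexive eq)) (*-cancelˡ-≤ 0<c (≤-reflexive (≈-sym eq)))

  abs : ℤ → Carrier
  abs z = fromℕ ∣ z ∣

  abs-linear : ∀ {z} → z ≢ 0ℤ → abs (1ℤ ℤ.+ z) + abs (ℤ.-1ℤ ℤ.+ z) ≈ fromℕ 2 * abs z
  abs-linear {+ zero}        z≢0 = contradiction refl z≢0
  abs-linear {+ suc n}       _   = solve 2 (λ n o → (o :+ (o :+ n)) :+ n := nat 2 :* (o :+ n)) ≈-refl (fromℕ n) 1#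
  abs-linear { -[1+ zero ]}  _   = solve 1 (λ _ → nat 0 :+ nat 2 := nat 2 :* nat 1) ≈-refl 0#
  abs-linear { -[1+ suc n ]} _   =
    solve 2 (λ n o → (o :+ n) :+ (o :+ (o :+ (o :+ n))) := nat 2 :* (o :+ (o :+ n))) ≈-refl (fromℕ n) 1#

  abs-convex : ∀ z → fromℕ 2 * abs z ≤ abs (1ℤ ℤ.+ z) + abs (ℤ.-1ℤ ℤ.+ z)
  abs-convex z with z ℤ.≟ 0ℤ
  ... | yes refl = ≤-diff (0≤fromℕ 2) (solve 1 (λ _ → (nat 1 :+ nat 1) :- nat 2 :* nat 0 := nat 2) ≈-refl 0#)
  ... | no z≢0   = ≤-reflexive (≈-sym (abs-linear z≢0))

  ι² : ∀ z → ι z * ι z ≈ abs z * abs z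
  ι² (+ n)    = ≈-refl
  ι² -[1+ n ] = solve 1 (λ a → (:- a) :* (:- a) := a :* a) ≈-refl (fromℕ (suc n))

  private
    clear-denominator : ∀ c s f → fromℕ (suc c) * (s / fromℕ (suc c) - f) ≈ s - fromℕ (suc c) * f
    clear-denominator c s f = ≈-trans
      (solve 4 (λ d d⁻¹ s f → d :* (s :* d⁻¹ :- f) := (d⁻¹ :* d) :* s :- d :* f) ≈-refl (fromℕ (suc c)) _ s f)
      (+-cong (≈-trans (*-cong (⁻¹-inverseˡ (0<fromℕ-suc c)) ≈-refl) (*-identityˡ s)) ≈-refl)

  -- Multiplied by the degree, so that no inverse reaches the ring solver; bounds on `Δ` follow by
  -- cancelling the positive factor. The same holds for `Δ-spine`.
  Δ-tooth : ∀ φ x {y} → y ≢ 0ℤ →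
            fromℕ 2 * Δ φ (x , y) ≈ φ (x , 1ℤ ℤ.+ y) + φ (x , ℤ.-1ℤ ℤ.+ y) - fromℕ 2 * φ (x , y)
  Δ-tooth φ x {+ zero} y≢0    = contradiction refl y≢0
  Δ-tooth φ x {y@(+ suc _)} _ = ≈-trans (clear-denominator 1 _ _) (+-cong (+-cong ≈-refl (+-identityʳ _)) ≈-refl)
  Δ-tooth φ x {y@(-[1+ _ ])} _ = ≈-trans (clear-denominator 1 _ _) (+-cong (+-cong ≈-refl (+-identityʳ _)) ≈-refl)

  Δ-spine : ∀ φ x → fromℕ 4 * Δ φ (x , 0ℤ) ≈
            (φ (x , 1ℤ) + φ (x , ℤ.-1ℤ)) + (φ (1ℤ ℤ.+ x , 0ℤ) + φ (ℤ.-1ℤ ℤ.+ x , 0ℤ)) - fromℕ 4 * φ (x , 0ℤ)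
  Δ-spine φ x = ≈-trans (clear-denominator 3 _ _) (+-cong
    (solve 4 (λ a b c d → a :+ (b :+ (c :+ (d :+ nat 0))) := (a :+ b) :+ (c :+ d)) ≈-refl _ _ _ _) ≈-refl)

  -- Written with `ι` rather than `abs`, because `ι` is additive and shifts of the argument become
  -- polynomial; `ι²` passes to `abs` when sizes are compared.
  squares : ℤ × ℤ → Carrier
  squares (x , y) = ι x * ι x + ι y * ι y

  private
    ι-step : ∀ z → ι (1ℤ ℤ.+ z) * ι (1ℤ ℤ.+ z) + ι (ℤ.-1ℤ ℤ.+ z) * ι (ℤ.-1ℤ ℤ.+ z) ≈
                   fromℕ 2 * (ι z * ι z) + fromℕ 2
    ι-step z = ≈-trans
      (+-cong (*-cong (ι-+ 1ℤ z) (ι-+ 1ℤ z)) (*-cong (ι-+ ℤ.-1ℤ z) (ι-+ ℤ.-1ℤ z)))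
      (solve 1 (λ a → (nat 1 :+ a) :* (nat 1 :+ a) :+ (con ℤ.-1ℤ :+ a) :* (con ℤ.-1ℤ :+ a) := nat 2 :* (a :* a) :+ nat 2)
        ≈-refl (ι z))

  -- A tooth vertex has a second difference of 2 in one direction and degree 2; a spine vertex has
  -- it in two directions and degree 4.
  Δ-squares : ∀ v → Δ squares v ≈ fromℕ 1
  Δ-squares (x , y) with y ℤ.≟ 0ℤ
  ... | no y≢0 = *-cancelˡ-≈ (0<fromℕ-suc 1) (≈-trans (Δ-tooth squares x y≢0)
          (≈-trans (solve 4 (λ a b c d → (a :+ b) :+ (a :+ c) :- nat 2 :* (a :+ d) := (b :+ c) :- nat 2 :* d)
                     ≈-refl (ι x * ι x) _ _ (ι y * ι y))
            (≈-trans (+-cong (ι-step y) ≈-refl)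
              (solve 1 (λ d → nat 2 :* d :+ nat 2 :- nat 2 :* d := nat 2 :* nat 1) ≈-refl (ι y * ι y)))))
  ... | yes refl = *-cancelˡ-≈ (0<fromℕ-suc 3) (≈-trans (Δ-spine squares x)
          (≈-trans (solve 3 (λ a b c →
                      ((a :+ nat 1 :* nat 1) :+ (a :+ con ℤ.-1ℤ :* con ℤ.-1ℤ)) :+ ((b :+ nat 0 :* nat 0) :+ (c :+ nat 0 :* nat 0))
                        :- nat 4 :* (a :+ nat 0 :* nat 0) := (b :+ c) :+ (nat 2 :- nat 2 :* a))
                     ≈-refl (ι x * ι x) _ _)
            (≈-trans (+-cong (ι-step x) ≈-refl)
              (solve 1 (λ a → nat 2 :* a :+ nat 2 :+ (nat 2 :- nat 2 :* a) := nat 4 :* nat 1) ≈-refl (ι x * ι x)))))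

  Δ-const : ∀ a v → Δ (λ _ → a) v ≈ 0#
  Δ-const a (x , y) with y ℤ.≟ 0ℤ
  ... | no y≢0   = *-cancelˡ-≈ (0<fromℕ-suc 1) (≈-trans (Δ-tooth (λ _ → a) x y≢0)
                     (solve 1 (λ a → a :+ a :- nat 2 :* a := nat 2 :* nat 0) ≈-refl a))
  ... | yes refl = *-cancelˡ-≈ (0<fromℕ-suc 3) (≈-trans (Δ-spine (λ _ → a) x)
                     (solve 1 (λ a → (a :+ a) :+ (a :+ a) :- nat 4 :* a := nat 4 :* nat 0) ≈-refl a))

-- The explicit kernel on the comb and the lower bound

truncated-square : ℕ → ℕ → ℕ
truncated-square K d = (K ∸ d) ℕ.* (K ∸ d)

-- The second difference is exactly 2 while the parabola lasts, 1 when its middle point is `K` and 0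
-- beyond. The recursion lowers `K` and `d` together.
truncated-square-step : ∀ K d → truncated-square K d ℕ.+ truncated-square K (2 ℕ.+ d) ℕ.≤
                                2 ℕ.* truncated-square K (suc d) ℕ.+ 2
truncated-square-step zero d rewrite ℕ.0∸n≡0 d = z≤n
truncated-square-step (suc zero) zero = s≤s z≤n
truncated-square-step (suc (suc K)) zero = ℕ.≤-reflexive
  (solveℕ 1 (λ K → (conℕ 2 ⊕ K) ⊗ (conℕ 2 ⊕ K) ⊕ K ⊗ K ⊜ conℕ 2 ⊗ ((conℕ 1 ⊕ K) ⊗ (conℕ 1 ⊕ K)) ⊕ conℕ 2) refl K)
truncated-square-step (suc K) (suc d) = truncated-square-step K d

module CombKernel (ℝ : Reals) (n K : ℕ)
  (K≥1 : 1 ℕ.≤ K) (n≥1 : 1 ℕ.≤ n) (2n≤K² : 2 ℕ.* n ℕ.≤ K ℕ.* K) where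
  open Reals ℝ
  open OrderedField ℝ
  open Potentials ℝ ℂ₂
  open Toppling ℝ ℂ₂
  open CombLaplacian ℝ
  open Pairing (box-unique n n)

  -- `c` is the drop guaranteed at every vertex. On the spine the corner of `r` at 0 has second
  -- difference of order - κ, and it is multiplied by two heights of order `N`.
  N κ c : Carrier
  N = fromℕ n
  κ = fromℕ K
  c = N * N * κ

  -- The second difference of (K ∸ d)² is at most 2 away from d = 0; on the spine it is
  -- dominated by the loss r / n ≥ κ² / n ≥ 2 along the teeth.
  r : ℤ → Carrier
  r z = κ * κ + fromℕ (truncated-square K ∣ z ∣)

  -- Linear along a tooth, hence harmonic off the spine, and at least `N` on the box. The factor
  -- `N - abs y` would vanish at the tips, and the positive contribution of `shared` in `Δg-spine-≡`
  -- could not be absorbed there.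
  height : ℤ → Carrier
  height y = fromℕ 2 * N - abs y

  -- Twice the length of the common part of the paths from (x , 0) to (x , y) and to (x , y′).
  shared : ℤ → ℤ → ℤ → ℤ → Carrier
  shared x x′ y y′ = if does (x ℤ.≟ x′) then abs y + abs y′ - abs (y′ ℤ.- y) else 0#

  -- The product is harmonic along the teeth and so gives no drop there. The second term is a Green
  -- function of the teeth killed on the spine, scaled to give the drop `c`; it vanishes as soon as
  -- one point is on the spine.
  g : ℤ × ℤ → ℤ × ℤ → Carrier
  g (x , y) (x′ , y′) = r (x′ ℤ.- x) * (height y * height y′) + c * shared x x′ y y′

  0≤c : 0# ≤ c
  0≤c = *-nonNeg (*-nonNeg (0≤fromℕ n) (0≤fromℕ n)) (0≤fromℕ K)

  2N≤κ² : fromℕ 2 * N ≤ κ * κ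
  2N≤κ² = ≤-respˡ-≈ (fromℕ-* 2 n) (≤-respʳ-≈ (fromℕ-* K K) (fromℕ-mono-≤ 2n≤K²))

  shared-≡ : ∀ x y y′ → shared x x y y′ ≈ abs y + abs y′ - abs (y′ ℤ.- y)
  shared-≡ x y y′ with x ℤ.≟ x
  ... | yes _  = ≈-refl
  ... | no x≢x = contradiction refl x≢x

  shared-≢ : ∀ {x x′} y y′ → x ≢ x′ → shared x x′ y y′ ≈ 0#
  shared-≢ {x} {x′} y y′ x≢x′ with x ℤ.≟ x′
  ... | yes x≡x′ = contradiction x≡x′ x≢x′
  ... | no _     = ≈-refl

  shared-0 : ∀ x x′ y → shared x x′ y 0ℤ ≈ 0#
  shared-0 x x′ y with x ℤ.≟ x′
  ... | yes _ = ≈-trans (+-cong ≈-refl (-‿cong (fromℕ-cong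
                  (≡.trans (≡.cong ∣_∣ (ℤ.+-identityˡ (ℤ.- y))) (ℤ.∣-i∣≡∣i∣ y)))))
                (solve 1 (λ a → a :+ nat 0 :- a := nat 0) ≈-refl (abs y))
  ... | no _  = ≈-refl

  shared-nonNeg : ∀ x x′ y y′ → 0# ≤ shared x x′ y y′
  shared-nonNeg x x′ y y′ with x ℤ.≟ x′
  ... | yes _ = ≤⇒0≤- (≤-respʳ-≈ (≈-trans (fromℕ-+ ∣ y′ ∣ ∣ y ∣) (+-comm _ _)) (fromℕ-mono-≤ (ℤ.∣i-j∣≤∣i∣+∣j∣ y′ y)))
  ... | no _  = ≤-refl

  r-sym : ∀ x x′ → r (x ℤ.- x′) ≈ r (x′ ℤ.- x)
  r-sym x x′ rewrite ℤ.∣i-j∣≡∣j-i∣ x x′ = ≈-refl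

  shared-sym : ∀ x x′ y y′ → shared x x′ y y′ ≈ shared x′ x y′ y
  shared-sym x x′ y y′ with x ℤ.≟ x′
  ... | yes refl = ≈-trans (+-cong (+-comm _ _) (-‿cong (fromℕ-cong (ℤ.∣i-j∣≡∣j-i∣ y′ y))))
                     (≈-sym (shared-≡ x y′ y))
  ... | no x≢x′  = ≈-sym (shared-≢ y′ y (x≢x′ ∘ ≡.sym))

  g-sym : ∀ u w → g u w ≈ g w u
  g-sym (x , y) (x′ , y′) = +-cong (*-cong (r-sym x′ x) (*-comm _ _)) (*-cong ≈-refl (shared-sym x x′ y y′))

  N≤height : ∀ y → ∣ y ∣ ℕ.≤ n → N ≤ height y
  N≤height y ∣y∣≤n = ≤-diff (≤⇒0≤- (fromℕ-mono-≤ ∣y∣≤n))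
    (solve 2 (λ n a → nat 2 :* n :- a :- n := n :- a) ≈-refl N (abs y))

  0≤height : ∀ y → ∣ y ∣ ℕ.≤ n → 0# ≤ height y
  0≤height y ∣y∣≤n = ≤-trans (0≤fromℕ n) (N≤height y ∣y∣≤n)

  0≤r : ∀ z → 0# ≤ r z
  0≤r z = +-nonNeg (0≤x*x κ) (0≤fromℕ (truncated-square K ∣ z ∣))

  g-nonNeg : ∀ {u w} → u ∈ box n n → w ∈ box n n → 0# ≤ g u w
  g-nonNeg {x , y} {x′ , y′} u∈ w∈ = +-nonNeg
    (*-nonNeg (0≤r (x′ ℤ.- x)) (*-nonNeg (0≤height y (proj₂ (∈-box⁻ n n u∈))) (0≤height y′ (proj₂ (∈-box⁻ n n w∈)))))
    (*-nonNeg 0≤c (shared-nonNeg x x′ y y′))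

  private
    ℤ-shift : ∀ e z w → (e ℤ.+ z) ℤ.- w ≡ e ℤ.+ (z ℤ.- w)
    ℤ-shift e z w = ℤ.+-assoc e z (ℤ.- w)

    abs-shift : ∀ e z w → abs ((e ℤ.+ z) ℤ.- w) ≈ abs (e ℤ.+ (z ℤ.- w))
    abs-shift e z w = fromℕ-cong (≡.cong ∣_∣ (ℤ-shift e z w))

    r-shift : ∀ e z w → r ((e ℤ.+ z) ℤ.- w) ≈ r (e ℤ.+ (z ℤ.- w))
    r-shift e z w = +-cong ≈-refl (fromℕ-cong (≡.cong (λ z → truncated-square K ∣ z ∣) (ℤ-shift e z w)))

  Δg-tooth : ∀ x′ y′ x {y} → y ≢ 0ℤ → fromℕ 2 * Δ (g (x′ , y′)) (x , y) ≈
             c * (shared x′ x y′ (1ℤ ℤ.+ y) + shared x′ x y′ (ℤ.-1ℤ ℤ.+ y) - fromℕ 2 * shared x′ x y′ y)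
  Δg-tooth x′ y′ x {y} y≢0 = ≈-trans (Δ-tooth (g (x′ , y′)) x y≢0)
    (≈-trans
      (solve 10 (λ r h n a b d c s t u →
        (r :* (h :* (nat 2 :* n :- a)) :+ c :* s) :+ (r :* (h :* (nat 2 :* n :- b)) :+ c :* t)
          :- nat 2 :* (r :* (h :* (nat 2 :* n :- d)) :+ c :* u)
        := c :* (s :+ t :- nat 2 :* u) :- r :* h :* ((a :+ b) :- nat 2 :* d))
        ≈-refl (r (x ℤ.- x′)) (height y′) N (abs (1ℤ ℤ.+ y)) (abs (ℤ.-1ℤ ℤ.+ y)) (abs y) c _ _ _)
      (≈-trans (+-cong ≈-refl (-‿cong (*-cong ≈-refl (+-cong (abs-linear y≢0) ≈-refl))))
        (solve 3 (λ c r a → c :- r :* (a :- a) := c) ≈-refl _ _ _)))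

  shared-diff : ∀ x y′ {y} → y ≢ 0ℤ →
    shared x x y′ (1ℤ ℤ.+ y) + shared x x y′ (ℤ.-1ℤ ℤ.+ y) - fromℕ 2 * shared x x y′ y ≈
    - ((abs (1ℤ ℤ.+ (y ℤ.- y′)) + abs (ℤ.-1ℤ ℤ.+ (y ℤ.- y′))) - fromℕ 2 * abs (y ℤ.- y′))
  shared-diff x y′ {y} y≢0 = ≈-trans
    (+-cong (+-cong (≈-trans (shared-≡ x y′ (1ℤ ℤ.+ y)) (+-cong ≈-refl (-‿cong (abs-shift 1ℤ y y′))))
                    (≈-trans (shared-≡ x y′ (ℤ.-1ℤ ℤ.+ y)) (+-cong ≈-refl (-‿cong (abs-shift ℤ.-1ℤ y y′)))))
            (-‿cong (*-cong ≈-refl (shared-≡ x y′ y))))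
    (≈-trans (solve 7 (λ b p m a q s t →
        (b :+ p :- q) :+ (b :+ m :- s) :- nat 2 :* (b :+ a :- t) := ((p :+ m) :- nat 2 :* a) :- ((q :+ s) :- nat 2 :* t))
        ≈-refl (abs y′) (abs (1ℤ ℤ.+ y)) (abs (ℤ.-1ℤ ℤ.+ y)) (abs y) _ _ _)
      (≈-trans (+-cong (+-cong (abs-linear y≢0) ≈-refl) ≈-refl)
        (solve 2 (λ a t → (a :- a) :- t := :- t) ≈-refl _ _)))

  Δg-tooth-≤0 : ∀ x′ y′ x {y} → y ≢ 0ℤ → Δ (g (x′ , y′)) (x , y) ≤ 0#
  Δg-tooth-≤0 x′ y′ x {y} y≢0 = *-cancelˡ-≤ (0<fromℕ-suc 1)
    (≤-respˡ-≈ (≈-sym (Δg-tooth x′ y′ x y≢0)) (≤-respʳ-≈ (≈-trans (zeroʳ c) (≈-sym (zeroʳ _)))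
      (*-monoˡ-≤ 0≤c (second-difference (x′ ℤ.≟ x)))))
    where
    second-difference : Dec (x′ ≡ x) →
      shared x′ x y′ (1ℤ ℤ.+ y) + shared x′ x y′ (ℤ.-1ℤ ℤ.+ y) - fromℕ 2 * shared x′ x y′ y ≤ 0#
    second-difference (no x′≢x) = ≤-reflexive (≈-trans
      (+-cong (+-cong (shared-≢ y′ (1ℤ ℤ.+ y) x′≢x) (shared-≢ y′ (ℤ.-1ℤ ℤ.+ y) x′≢x))
              (-‿cong (*-cong ≈-refl (shared-≢ y′ y x′≢x))))
      (solve 1 (λ _ → nat 0 :+ nat 0 :- nat 2 :* nat 0 := nat 0) ≈-refl 0#))
    second-difference (yes refl) = ≤-respˡ-≈ (≈-sym (shared-diff x y′ y≢0))
      (≤-respʳ-≈ (solve 1 (λ _ → :- nat 0 := nat 0) ≈-refl 0#) (neg-mono-≤ (≤⇒0≤- (abs-convex (y ℤ.- y′)))))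

  Δg-tooth-≡ : ∀ x {y} → y ≢ 0ℤ → Δ (g (x , y)) (x , y) ≤ - c
  Δg-tooth-≡ x {y} y≢0 = *-cancelˡ-≤ (0<fromℕ-suc 1) (≤-reflexive
    (≈-trans (Δg-tooth x y x y≢0) (≈-trans (*-cong ≈-refl (≈-trans (shared-diff x y y≢0)
      (-‿cong (+-cong (+-cong (shifted 1ℤ) (shifted ℤ.-1ℤ)) (-‿cong (*-cong ≈-refl (fromℕ-cong (≡.cong ∣_∣ (ℤ.+-inverseʳ y)))))))))
      (solve 1 (λ c → c :* (:- ((nat 1 :+ nat 1) :- nat 2 :* nat 0)) := nat 2 :* (:- c)) ≈-refl c))))
    where
    shifted : ∀ e → abs (e ℤ.+ (y ℤ.- y)) ≈ abs e
    shifted e = fromℕ-cong (≡.cong ∣_∣ (≡.trans (≡.cong (λ z → e ℤ.+ z) (ℤ.+-inverseʳ y)) (ℤ.+-identityʳ e)))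

  truncated-square-ℤ : ∀ {z} → z ≢ 0ℤ → truncated-square K ∣ 1ℤ ℤ.+ z ∣ ℕ.+ truncated-square K ∣ ℤ.-1ℤ ℤ.+ z ∣ ℕ.≤
                       2 ℕ.* truncated-square K ∣ z ∣ ℕ.+ 2
  truncated-square-ℤ {+ zero}        z≢0 = contradiction refl z≢0
  truncated-square-ℤ {+ suc d}       _   =
    ℕ.≤-trans (ℕ.≤-reflexive (ℕ.+-comm (truncated-square K (2 ℕ.+ d)) _)) (truncated-square-step K d)
  truncated-square-ℤ { -[1+ zero ]}  _   = truncated-square-step K 0
  truncated-square-ℤ { -[1+ suc d ]} _   = truncated-square-step K (suc d)

  r-step : ∀ {z} → z ≢ 0ℤ → r (1ℤ ℤ.+ z) + r (ℤ.-1ℤ ℤ.+ z) ≤ fromℕ 2 * r z + fromℕ 2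
  r-step {z} z≢0 = ≤-respˡ-≈ (solve 3 (λ q a b → nat 2 :* q :+ (a :+ b) := (q :+ a) :+ (q :+ b)) ≈-refl (κ * κ) _ _)
    (≤-respʳ-≈ (solve 2 (λ q a → nat 2 :* q :+ (nat 2 :* a :+ nat 2) := nat 2 :* (q :+ a) :+ nat 2) ≈-refl (κ * κ) _)
      (+-monoʳ-≤ (fromℕ 2 * (κ * κ)) (≤-respˡ-≈ (fromℕ-+ (truncated-square K ∣ 1ℤ ℤ.+ z ∣) _)
        (≤-respʳ-≈ (≈-trans (fromℕ-+ (2 ℕ.* truncated-square K ∣ z ∣) 2)
                     (+-cong (fromℕ-* 2 (truncated-square K ∣ z ∣)) ≈-refl))
          (fromℕ-mono-≤ (truncated-square-ℤ z≢0))))))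

  -- The factor of height y′ is the Laplacian of r on the spine, minus the loss along the two teeth.
  Δg-spine : ∀ x′ y′ x → fromℕ 4 * Δ (g (x′ , y′)) (x , 0ℤ) ≈
    height y′ * (fromℕ 2 * N * (r (1ℤ ℤ.+ (x ℤ.- x′)) + r (ℤ.-1ℤ ℤ.+ (x ℤ.- x′)) - fromℕ 2 * r (x ℤ.- x′))
                 - fromℕ 2 * r (x ℤ.- x′))
    + c * (shared x′ x y′ 1ℤ + shared x′ x y′ ℤ.-1ℤ)
  Δg-spine x′ y′ x = ≈-trans (Δ-spine (g (x′ , y′)) x) (≈-trans
    (+-cong (+-cong ≈-refl (+-cong (horizontal 1ℤ) (horizontal ℤ.-1ℤ))) (-‿cong (*-cong ≈-refl
      (+-cong ≈-refl (*-cong ≈-refl (shared-0 x′ x y′))))))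
    (solve 8 (λ a b d h n c s t →
      ((a :* (h :* (nat 2 :* n :- nat 1)) :+ c :* s) :+ (a :* (h :* (nat 2 :* n :- nat 1)) :+ c :* t))
        :+ ((b :* (h :* (nat 2 :* n :- nat 0)) :+ c :* nat 0) :+ (d :* (h :* (nat 2 :* n :- nat 0)) :+ c :* nat 0))
        :- nat 4 :* (a :* (h :* (nat 2 :* n :- nat 0)) :+ c :* nat 0)
      := h :* (nat 2 :* n :* (b :+ d :- nat 2 :* a) :- nat 2 :* a) :+ c :* (s :+ t))
      ≈-refl (r (x ℤ.- x′)) (r (1ℤ ℤ.+ (x ℤ.- x′))) (r (ℤ.-1ℤ ℤ.+ (x ℤ.- x′))) (height y′) N c _ _))
    where
    horizontal : ∀ e → g (x′ , y′) (e ℤ.+ x , 0ℤ) ≈ r (e ℤ.+ (x ℤ.- x′)) * (height y′ * height 0ℤ) + c * 0#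
    horizontal e = +-cong (*-cong (r-shift e x x′) ≈-refl) (*-cong ≈-refl (shared-0 x′ (e ℤ.+ x) y′))

  Δg-spine-≢ : ∀ {x′ y′ x} → ∣ y′ ∣ ℕ.≤ n → x′ ≢ x → Δ (g (x′ , y′)) (x , 0ℤ) ≤ 0#
  Δg-spine-≢ {x′} {y′} {x} ∣y′∣≤n x′≢x = *-cancelˡ-≤ (0<fromℕ-suc 3)
    (≤-respˡ-≈ (≈-sym (Δg-spine x′ y′ x)) (≤-diff
      (+-nonNeg
        (*-nonNeg (0≤height y′ ∣y′∣≤n) (+-nonNeg
          (*-nonNeg (*-nonNeg (0≤fromℕ 2) (0≤fromℕ n)) (≤⇒0≤- (r-step x-x′≢0)))
          (+-nonNeg (*-nonNeg (0≤fromℕ 2) (≤⇒0≤- 2N≤κ²)) (*-nonNeg (0≤fromℕ 2) (0≤fromℕ (truncated-square K ∣ z ∣))))))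
        (≤-reflexive (≈-sym shared≈0)))
      (≈-trans (solve 8 (λ h n b d q a c t →
          nat 4 :* nat 0 :- (h :* (nat 2 :* n :* (b :+ d :- nat 2 :* (q :+ a)) :- nat 2 :* (q :+ a)) :+ c :* t)
          := h :* (nat 2 :* n :* (nat 2 :* (q :+ a) :+ nat 2 :- (b :+ d)) :+ (nat 2 :* (q :- nat 2 :* n) :+ nat 2 :* a)) :- c :* t)
          ≈-refl (height y′) N (r (1ℤ ℤ.+ z)) (r (ℤ.-1ℤ ℤ.+ z)) (κ * κ) (fromℕ (truncated-square K ∣ z ∣)) c _)
        (+-cong ≈-refl (≈-trans (-‿cong shared≈0) (≈-trans (solve 1 (λ _ → :- nat 0 := nat 0) ≈-refl 0#) (≈-sym shared≈0)))))))
    where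
    z = x ℤ.- x′
    x-x′≢0 : z ≢ 0ℤ
    x-x′≢0 eq = x′≢x (≡.sym (ℤ.i-j≡0⇒i≡j x x′ eq))
    shared≈0 : c * (shared x′ x y′ 1ℤ + shared x′ x y′ ℤ.-1ℤ) ≈ 0#
    shared≈0 = ≈-trans (*-cong ≈-refl (≈-trans (+-cong (shared-≢ y′ 1ℤ x′≢x) (shared-≢ y′ ℤ.-1ℤ x′≢x)) (+-identityˡ 0#))) (zeroʳ c)

  r-1 : r 1ℤ ≈ fromℕ 2 * (κ * κ) - fromℕ 2 * κ + fromℕ 1
  r-1 = ≈-trans (+-cong ≈-refl (≈-trans (fromℕ-* (K ∸ 1) (K ∸ 1)) (*-cong pred pred)))
    (solve 1 (λ a → a :* a :+ (a :- nat 1) :* (a :- nat 1) := nat 2 :* (a :* a) :- nat 2 :* a :+ nat 1) ≈-refl κ)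
    where
    pred : fromℕ (K ∸ 1) ≈ κ - fromℕ 1
    pred = ≈-trans (solve 1 (λ a → a := a :+ nat 1 :- nat 1) ≈-refl _)
      (+-cong (≈-trans (≈-sym (fromℕ-+ (K ∸ 1) 1)) (fromℕ-cong (ℕ.m∸n+n≡m K≥1))) ≈-refl)

  r-0 : r 0ℤ ≈ fromℕ 2 * (κ * κ)
  r-0 = ≈-trans (+-cong ≈-refl (fromℕ-* K K)) (solve 1 (λ q → q :+ q := nat 2 :* q) ≈-refl (κ * κ))

  -- The second difference of `r` at its corner is 2 - 4κ in each of the two summed halves taken
  -- together as 2 (1 - 2κ), so the κ part contributes at most - 8 c. Of this, 4 c is the claim, at
  -- most 2 c pays for `shared`, and 2 c is left over. The constant part 2 costs 4 N times the
  -- height and is covered by the tooth loss 4 κ² times the height.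
  Δg-spine-≡ : ∀ {y′} x → ∣ y′ ∣ ℕ.≤ n → Δ (g (x , y′)) (x , 0ℤ) ≤ - c
  Δg-spine-≡ {y′} x ∣y′∣≤n = *-cancelˡ-≤ (0<fromℕ-suc 3)
    (≤-respˡ-≈ (≈-sym (≈-trans (Δg-spine x y′ x) (+-cong (*-cong ≈-refl
        (+-cong (*-cong ≈-refl (+-cong (+-cong (≈-trans (r-cong 1ℤ) r-1) (≈-trans (r-cong ℤ.-1ℤ) r-1))
                                       (-‿cong (*-cong ≈-refl r-diag))))
                (-‿cong (*-cong ≈-refl r-diag))))
        (*-cong ≈-refl (+-cong (shared-≡ x y′ 1ℤ) (shared-≡ x y′ ℤ.-1ℤ))))))
    (≤-diff
      (+-nonNeg (+-nonNeg
        (*-nonNeg (*-nonNeg (0≤fromℕ 8) (*-nonNeg (0≤fromℕ n) (0≤fromℕ K))) (≤⇒0≤- (N≤height y′ ∣y′∣≤n)))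
        (*-nonNeg (0≤height y′ ∣y′∣≤n) (+-nonNeg (*-nonNeg (0≤fromℕ 2) (≤⇒0≤- 2N≤κ²)) (*-nonNeg (0≤fromℕ 2) (0≤x*x κ)))))
        (+-nonNeg (*-nonNeg 0≤c (≤⇒0≤- teeth)) (*-nonNeg (0≤fromℕ 2) 0≤c)))
      (solve 6 (λ h n κ a p q →
        nat 4 :* (:- (n :* n :* κ)) :-
          (h :* (nat 2 :* n :* ((nat 2 :* (κ :* κ) :- nat 2 :* κ :+ nat 1) :+ (nat 2 :* (κ :* κ) :- nat 2 :* κ :+ nat 1)
                    :- nat 2 :* (nat 2 :* (κ :* κ))) :- nat 2 :* (nat 2 :* (κ :* κ)))
           :+ n :* n :* κ :* ((a :+ nat 1 :- p) :+ (a :+ nat 1 :- q)))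
        := nat 8 :* (n :* κ) :* (h :- n) :+ h :* (nat 2 :* (κ :* κ :- nat 2 :* n) :+ nat 2 :* (κ :* κ))
           :+ (n :* n :* κ :* (p :+ q :- nat 2 :* a) :+ nat 2 :* (n :* n :* κ)))
        ≈-refl (height y′) N κ (abs y′) (abs (1ℤ ℤ.- y′)) (abs (ℤ.-1ℤ ℤ.- y′)))))
    where
    r-cong : ∀ e → r (e ℤ.+ (x ℤ.- x)) ≈ r e
    r-cong e rewrite ℤ.+-inverseʳ x | ℤ.+-identityʳ e = ≈-refl
    r-diag : r (x ℤ.- x) ≈ fromℕ 2 * (κ * κ)
    r-diag rewrite ℤ.+-inverseʳ x = r-0
    teeth : fromℕ 2 * abs y′ ≤ abs (1ℤ ℤ.- y′) + abs (ℤ.-1ℤ ℤ.- y′)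
    teeth = ≤-respˡ-≈ (*-cong ≈-refl (fromℕ-cong (ℤ.∣-i∣≡∣i∣ y′))) (abs-convex (ℤ.- y′))

  Δg-≤0 : ∀ {u v} → u ∈ box n n → norm v ℕ.< n → Δ (g u) v ≤ 0#
  Δg-≤0 {x′ , y′} {x , y} u∈ _ with y ℤ.≟ 0ℤ
  ... | no y≢0 = Δg-tooth-≤0 x′ y′ x y≢0
  ... | yes refl = spine (x′ ℤ.≟ x)
    where
    spine : Dec (x′ ≡ x) → Δ (g (x′ , y′)) (x , 0ℤ) ≤ 0#
    spine (no x′≢x)  = Δg-spine-≢ {y′ = y′} (proj₂ (∈-box⁻ n n u∈)) x′≢x
    spine (yes refl) = ≤-trans (Δg-spine-≡ {y′} x (proj₂ (∈-box⁻ n n u∈)))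
                         (≤-respʳ-≈ (solve 1 (λ _ → :- nat 0 := nat 0) ≈-refl 0#) (neg-mono-≤ 0≤c))

  Δg-≤-c : ∀ {v} → norm v ℕ.< n → Δ (g v) v ≤ - c
  Δg-≤-c {x , y} _ with y ℤ.≟ 0ℤ
  ... | no y≢0   = Δg-tooth-≡ x y≢0
  ... | yes refl = Δg-spine-≡ {0ℤ} x z≤n

  -- The factor 2 makes it nonpositive off the ball, through 2 (a² + b²) ≥ (a + b)², while its value
  -- at `o` is its maximum `N * N`.
  φ : ℤ × ℤ → Carrier
  φ v = N * N + - fromℕ 2 * squares v

  Δφ : ∀ v → Δ φ v ≈ - fromℕ 2
  Δφ v = ≈-trans (Δ-+* (λ _ → N * N) (- fromℕ 2) squares v)
    (≈-trans (+-cong (Δ-const (N * N) v) (*-cong ≈-refl (Δ-squares v)))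
      (solve 1 (λ _ → nat 0 :+ :- nat 2 :* nat 1 := :- nat 2) ≈-refl 0#))

  φ≤N² : ∀ v → φ v ≤ N * N
  φ≤N² (x , y) = ≤-diff (*-nonNeg (0≤fromℕ 2) (+-nonNeg (0≤x*x (ι x)) (0≤x*x (ι y))))
    (solve 2 (λ a s → a :- (a :+ :- nat 2 :* s) := nat 2 :* s) ≈-refl (N * N) _)

  φ≤0 : ∀ {v} → ¬ norm v ℕ.< n → φ v ≤ 0#
  φ≤0 {x , y} v∉A = ≤-trans
    (≤-reflexive (+-cong ≈-refl (*-cong ≈-refl (+-cong (ι² x) (ι² y)))))
    (≤-diff (+-nonNeg (0≤x*x (abs x - abs y)) (≤⇒0≤- N²≤norm²))
      (solve 3 (λ n a b → nat 0 :- (n :* n :+ :- nat 2 :* (a :* a :+ b :* b))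
        := (a :- b) :* (a :- b) :+ ((a :+ b) :* (a :+ b) :- n :* n)) ≈-refl N (abs x) (abs y)))
    where
    N≤norm : N ≤ abs x + abs y
    N≤norm = ≤-respʳ-≈ (fromℕ-+ ∣ x ∣ ∣ y ∣) (fromℕ-mono-≤ (ℕ.≮⇒≥ v∉A))
    N²≤norm² : N * N ≤ (abs x + abs y) * (abs x + abs y)
    N²≤norm² = *-mono-≤ (0≤fromℕ n) (≤-trans (0≤fromℕ n) N≤norm) N≤norm N≤norm

  interior : ∀ {v} → norm v ℕ.< n → Interior v
  interior {x , y} lt = ∈-box⁺ ∣x∣≤n ∣y∣≤n , All.tabulate nbr
    where
    ∣x∣≤n : ∣ x ∣ ℕ.≤ n
    ∣x∣≤n = ℕ.≤-trans (ℕ.m≤m+n ∣ x ∣ ∣ y ∣) (ℕ.<⇒≤ lt)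
    ∣y∣≤n : ∣ y ∣ ℕ.≤ n
    ∣y∣≤n = ℕ.≤-trans (ℕ.m≤n+m ∣ y ∣ ∣ x ∣) (ℕ.<⇒≤ lt)
    nbr : ∀ {w} → w ∈ combNbrs (x , y) → w ∈ box n n
    nbr {x′ , y′} w∈ = ∈-box⁺ (ℕ.≤-trans (ℕ.m≤m+n ∣ x′ ∣ ∣ y′ ∣) w≤n) (ℕ.≤-trans (ℕ.m≤n+m ∣ y′ ∣ ∣ x′ ∣) w≤n)
      where
      w≤n : norm (x′ , y′) ℕ.≤ n
      w≤n = ℕ.≤-trans (norm-step {v = x , y} (Equivalence.to (∈-combNbrs (x , y) (x′ , y′)) w∈)) lt

  -- Dividing `raw` by `c` leaves σ N² q ≤ j + 8 κ σ², where 8 κ is g(o , o) / c. The best σ turns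
  -- this into q² N⁴ / (32 κ) ≤ j; the identity used is the completed square, whose square term
  -- vanishes by `σ-spec`.
  topplings-lower : ∀ {j ν q vs} → 0# ≤ q → unitMass o ⟶[ j ] ν → Unique vs → All (¬_ ∘ Graph.Ball ℂ₂ o n) vs →
    q ≤ Σ[ vs ] (mass ν) → q * q * (N * N * (N * N)) ≤ fromℕ 32 * κ * fromℕ j
  topplings-lower {j} {ν} {q} {vs} 0≤q steps unique-vs vs∉Ball q≤Σ = ≤-diff
    (*-nonNeg (*-nonNeg (0≤fromℕ 32) (0≤fromℕ K)) (≤⇒0≤- bound))
    (≈-trans (solve 5 (λ q n κ j σ →
        nat 32 :* κ :* j :- q :* q :* (n :* n :* (n :* n))
        := nat 32 :* κ :* (j :+ nat 8 :* (σ :* σ) :* κ :- σ :* (n :* n) :* q)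
           :- (nat 16 :* κ :* σ :- q :* (n :* n)) :* (nat 16 :* κ :* σ :- q :* (n :* n))) ≈-refl q N κ (fromℕ j) σ)
      (≈-trans (+-cong ≈-refl (-‿cong (*-cong σ-spec σ-spec)))
        (solve 1 (λ a → a :- nat 0 :* nat 0 := a) ≈-refl _)))
    where
    0<κ : 0# < κ
    0<κ = 0<fromℕ K≥1
    0<16κ : 0# < fromℕ 16 * κ
    0<16κ = *-pos (0<fromℕ-suc 15) 0<κ
    0<N : 0# < N
    0<N = 0<fromℕ n≥1

    -- The maximiser of q N² σ - 8 κ σ².
    σ : Carrier
    σ = q * (N * N) * (fromℕ 16 * κ) ⁻¹

    0≤σ : 0# ≤ σ
    0≤σ = *-nonNeg (*-nonNeg 0≤q (*-nonNeg (0≤fromℕ n) (0≤fromℕ n))) (proj₁ (⁻¹-pos 0<16κ))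

    σ-spec : fromℕ 16 * κ * σ - q * (N * N) ≈ 0#
    σ-spec = ≈-trans (+-cong (≈-trans (solve 3 (λ a b c → a :* (b :* c) := b :* (c :* a)) ≈-refl _ _ _)
        (≈-trans (*-cong ≈-refl (⁻¹-inverseˡ 0<16κ)) (*-identityʳ _))) ≈-refl) (-‿inverseʳ _)

    open LowerBound ℝ ℂ₂

    raw : σ * c * φ o - σ * σ * g o o - fromℕ j * c ≤ σ * c * (N * N * (1# - q))
    raw = topplings≥ (box-unique n n) (λ v → norm v ℕ.<? n) interior φ (*-nonNeg (0≤fromℕ n) (0≤fromℕ n))
      φ≤N² (λ {u} → φ≤0 {u}) Δφ g g-sym (λ {u} {w} → g-nonNeg {u} {w}) 0≤c
      (λ {u} {v} → Δg-≤0 {u} {v}) (λ {v} → Δg-≤-c {v}) 0≤σ o n≥1 steps unique-vs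
      (All.map (λ {v} v∉Ball lt → v∉Ball (∈Ball v lt)) vs∉Ball) q≤Σ

    g-o : g o o ≈ fromℕ 8 * (κ * κ) * (N * N)
    g-o = ≈-trans (+-cong (*-cong r-0 ≈-refl) (*-cong ≈-refl (shared-0 0ℤ 0ℤ 0ℤ)))
      (solve 3 (λ κ n c → nat 2 :* (κ :* κ) :* ((nat 2 :* n :- nat 0) :* (nat 2 :* n :- nat 0)) :+ c :* nat 0
        := nat 8 :* (κ :* κ) :* (n :* n)) ≈-refl κ N c)

    bound : σ * (N * N) * q ≤ fromℕ j + fromℕ 8 * (σ * σ) * κ
    bound = *-cancelˡ-≤ (*-pos (*-pos 0<N 0<N) 0<κ) (≤-diff (≤⇒0≤- raw)
      (≈-sym (≈-trans (+-cong (*-cong ≈-refl (*-cong ≈-refl (+-cong (≈-sym (+-identityʳ 1#)) ≈-refl)))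
          (-‿cong (+-cong (+-cong ≈-refl (-‿cong (*-cong ≈-refl g-o))) ≈-refl)))
        (solve 5 (λ q n κ j σ →
          σ :* (n :* n :* κ) :* (n :* n :* (nat 1 :- q))
            :- (σ :* (n :* n :* κ) :* (n :* n :+ :- nat 2 :* (nat 0 :* nat 0 :+ nat 0 :* nat 0))
                :- σ :* σ :* (nat 8 :* (κ :* κ) :* (n :* n)) :- j :* (n :* n :* κ))
          := n :* n :* κ :* (j :+ nat 8 :* (σ :* σ) :* κ) :- n :* n :* κ :* (σ :* (n :* n) :* q))
          ≈-refl q N κ (fromℕ j) σ))))

-- The toppling strategy and the upper bound

if-yes : ∀ {P A : Set} (P? : Dec P) {a b : A} → P → (if does P? then a else b) ≡ a
if-yes (yes _) _ = refl
if-yes (no ¬p) p = contradiction p ¬p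

if-no : ∀ {P A : Set} (P? : Dec P) {a b : A} → ¬ P → (if does P? then a else b) ≡ b
if-no (yes p) ¬p = contradiction p ¬p
if-no (no _)  _  = refl

module CombTransport (ℝ : Reals) (n K q : ℕ)
  (K≥1 : 1 ℕ.≤ K) (n≥1 : 1 ℕ.≤ n) (q≥1 : 1 ℕ.≤ q) (n≤K² : n ℕ.≤ K ℕ.* K) where
  open Reals ℝ
  open OrderedField ℝ
  open Potentials ℝ ℂ₂
  open Conservation ℝ ℂ₂
  open Toppling ℝ ℂ₂
  open CombLaplacian ℝ

  width : ℕ
  width = q ℕ.* K

  L : List (ℤ × ℤ)
  L = box width n

  open Pairing (box-unique width n)

  -- The accuracy is 1/q. `θ` is such that vertices of mass at most `θ` hold at most 1/q in total
  -- over the box; `F` bounds `squares` on the box.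
  N X Q ∣L∣ W F θ : Carrier
  N = fromℕ n
  X = fromℕ width
  Q = fromℕ q
  ∣L∣ = fromℕ (length L)
  W = (N + X * X) * N
  F = X * X + N * N
  θ = (Q * ∣L∣) ⁻¹

  0<N : 0# < N
  0<N = 0<fromℕ n≥1

  0<Q : 0# < Q
  0<Q = 0<fromℕ q≥1

  0<∣L∣ : 0# < ∣L∣
  0<∣L∣ = 0<fromℕ (ℕ.≤-trans (s≤s z≤n) (ℕ.≤-reflexive (≡.sym
    (≡.trans (length-cartesianProduct (interval width) (interval n))
      (≡.cong₂ ℕ._*_ (length-interval width) (length-interval n))))))

  0<θ : 0# < θ
  0<θ = ⁻¹-pos (*-pos 0<Q 0<∣L∣)

  θ-spec : θ * (Q * ∣L∣) ≈ 1#
  θ-spec = ⁻¹-inverseˡ (*-pos 0<Q 0<∣L∣)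

  0<W : 0# < W
  0<W = *-pos (<-≤-trans 0<N (≤-diff (0≤x*x X) (solve 2 (λ n x → (n :+ x) :- n := x) ≈-refl N (X * X)))) 0<N

  -- H takes the value W at the ends (± width , 0) of the spine, and N² at the origin.
  H : ℤ × ℤ → Carrier
  H (x , y) = (N + ι x * ι x) * (N - abs y)

  -- Within the box, these are the vertices whose neighbours all lie in the box. The teeth over the
  -- two ends of the spine stay free, because no horizontal edge leaves them.
  Free : ℤ × ℤ → Set
  Free (x , y) = ∣ y ∣ ℕ.< n × (y ≡ 0ℤ → ∣ x ∣ ℕ.< width)

  free? : Decidable Free
  free? (x , y) = (∣ y ∣ ℕ.<? n) ×-dec ((y ℤ.≟ 0ℤ) →-dec (∣ x ∣ ℕ.<? width))

  Outside : ℤ × ℤ → Set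
  Outside (x , y) = n ℕ.≤ ∣ y ∣

  outside? : Decidable Outside
  outside? (x , y) = n ℕ.≤? ∣ y ∣

  Free⇒interior : ∀ {v} → v ∈ L → Free v → Interior v
  Free⇒interior {x , y} v∈L (∣y∣<n , spine) = v∈L , nbrs y ∣y∣<n spine
    where
    ∣x∣≤ : ∣ x ∣ ℕ.≤ width
    ∣x∣≤ = proj₁ (∈-box⁻ width n v∈L)
    nbr : ∀ {j b} e → ∣ e ∣ ≡ 1 → ∣ j ∣ ℕ.< b → ∣ e ℤ.+ j ∣ ℕ.≤ b
    nbr {j} e eq lt = ℕ.≤-trans (∣∣-neighbour j e eq refl) lt
    nbrs : ∀ y → ∣ y ∣ ℕ.< n → (y ≡ 0ℤ → ∣ x ∣ ℕ.< width) → All (_∈ L) (combNbrs (x , y))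
    nbrs (+ zero) lt spine = ∈-box⁺ ∣x∣≤ (nbr {0ℤ} 1ℤ refl lt) ∷ ∈-box⁺ ∣x∣≤ (nbr {0ℤ} ℤ.-1ℤ refl lt) ∷
      ∈-box⁺ (nbr {x} 1ℤ refl (spine refl)) z≤n ∷ ∈-box⁺ (nbr {x} ℤ.-1ℤ refl (spine refl)) z≤n ∷ []
    nbrs y@(+ suc _) lt _ = ∈-box⁺ ∣x∣≤ (nbr {y} 1ℤ refl lt) ∷ ∈-box⁺ ∣x∣≤ (nbr {y} ℤ.-1ℤ refl lt) ∷ []
    nbrs y@(-[1+ _ ]) lt _ = ∈-box⁺ ∣x∣≤ (nbr {y} 1ℤ refl lt) ∷ ∈-box⁺ ∣x∣≤ (nbr {y} ℤ.-1ℤ refl lt) ∷ []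

  -- Along a tooth `H` is linear. On the spine the second difference of x² contributes 2 N and the
  -- two teeth cost 2 (N + x²); the summand `N` in the first factor is there to balance this, and -
  -- 2 x² remains.
  ΔH≤0 : ∀ v → Δ H v ≤ 0#
  ΔH≤0 (x , y) with y ℤ.≟ 0ℤ
  ... | no y≢0 = ≤-reflexive (*-cancelˡ-≈ (0<fromℕ-suc 1) (≈-trans (Δ-tooth H x y≢0) (≈-trans
          (solve 5 (λ h n a b c → h :* (n :- a) :+ h :* (n :- b) :- nat 2 :* (h :* (n :- c)) := h :* (nat 2 :* c :- (a :+ b)))
            ≈-refl (N + ι x * ι x) N (abs (1ℤ ℤ.+ y)) (abs (ℤ.-1ℤ ℤ.+ y)) (abs y))
          (≈-trans (*-cong ≈-refl (+-cong ≈-refl (-‿cong (abs-linear y≢0))))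
            (solve 2 (λ h a → h :* (a :- a) := nat 2 :* nat 0) ≈-refl _ _)))))
  ... | yes refl = *-cancelˡ-≤ (0<fromℕ-suc 3) (≤-respˡ-≈ (≈-sym (≈-trans (Δ-spine H x)
          (+-cong (+-cong ≈-refl (+-cong
            (*-cong (+-cong ≈-refl (*-cong (ι-+ 1ℤ x) (ι-+ 1ℤ x))) ≈-refl)
            (*-cong (+-cong ≈-refl (*-cong (ι-+ ℤ.-1ℤ x) (ι-+ ℤ.-1ℤ x))) ≈-refl))) ≈-refl)))
          (≤-diff (*-nonNeg (0≤fromℕ 2) (0≤x*x (ι x)))
            (solve 2 (λ n x → nat 4 :* nat 0 :-
               (((n :+ x :* x) :* (n :- nat 1) :+ (n :+ x :* x) :* (n :- nat 1))
                :+ ((n :+ (nat 1 :+ x) :* (nat 1 :+ x)) :* (n :- nat 0) :+ (n :+ (con ℤ.-1ℤ :+ x) :* (con ℤ.-1ℤ :+ x)) :* (n :- nat 0))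
                :- nat 4 :* ((n :+ x :* x) :* (n :- nat 0)))
              := nat 2 :* (x :* x)) ≈-refl N (ι x))))

  squares≤F : ∀ {v} → v ∈ L → squares v ≤ F
  squares≤F {x , y} v∈L = ≤-respˡ-≈ (≈-sym (+-cong (ι² x) (ι² y))) (+-mono-≤
    (square ∣ x ∣ width (proj₁ (∈-box⁻ width n v∈L))) (square ∣ y ∣ n (proj₂ (∈-box⁻ width n v∈L))))
    where
    square : ∀ i j → i ℕ.≤ j → fromℕ i * fromℕ i ≤ fromℕ j * fromℕ j
    square i j i≤j = *-mono-≤ (0≤fromℕ i) (0≤fromℕ j) (fromℕ-mono-≤ i≤j) (fromℕ-mono-≤ i≤j)

  one : ℤ × ℤ → Carrier
  one _ = 1#

  out : (ℤ × ℤ → Carrier) → Carrier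
  out μ = Σ[ filter outside? L ] μ

  Exhausted : (ℤ × ℤ → Carrier) → Set
  Exhausted μ = ∀ {v} → v ∈ L → Free v → μ v ≤ θ

  module _ {μ} (0≤μ : ∀ v → 0# ≤ μ v) (total : ⟨ μ , one ⟩ ≈ 1#) (H≤ : ⟨ μ , H ⟩ ≤ N * N)
    (exhausted : Exhausted μ) where
    ind : ℤ × ℤ → Carrier
    ind v = if does (outside? v) then μ v else 0#

    0≤height : ∀ {x y} → (x , y) ∈ L → 0# ≤ N - abs y
    0≤height v∈L = ≤⇒0≤- (fromℕ-mono-≤ (proj₂ (∈-box⁻ width n v∈L)))

    0≤μH : ∀ {v} → v ∈ L → 0# ≤ μ v * H v
    0≤μH {x , y} v∈L = *-nonNeg (0≤μ (x , y))
      (*-nonNeg (+-nonNeg (0≤fromℕ n) (0≤x*x (ι x))) (0≤height v∈L))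

    0≤Wθ : 0# ≤ W * θ
    0≤Wθ = *-nonNeg (proj₁ 0<W) (proj₁ 0<θ)

    ind-yes : ∀ {v} → Outside v → ind v ≈ μ v
    ind-yes {v} out = ≡⇒≈ (if-yes (outside? v) out)

    ind-no : ∀ {v} → ¬ Outside v → ind v ≈ 0#
    ind-no {v} ¬out = ≡⇒≈ (if-no (outside? v) ¬out)

    0≤Wind : ∀ v → 0# ≤ W * ind v
    0≤Wind v = *-nonNeg (proj₁ 0<W) (0≤ind (outside? v))
      where
      0≤ind : Dec (Outside v) → 0# ≤ ind v
      0≤ind (yes out) = ≤-respʳ-≈ (≈-sym (ind-yes {v} out)) (0≤μ v)
      0≤ind (no ¬out) = ≤-reflexive (≈-sym (ind-no {v} ¬out))

    -- Each vertex is charged to one summand: a free one to `θ`, a tip to `ind`, and an end of the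
    -- spine to `H`, which equals `W` there.
    pointwise : ∀ {v} → v ∈ L → W * μ v ≤ W * θ + (μ v * H v + W * ind v)
    pointwise {v@(x , y)} v∈L with free? v
    ... | yes free = ≤-trans (*-monoˡ-≤ (proj₁ 0<W) (exhausted v∈L free))
            (≤-diff (+-nonNeg (0≤μH v∈L) (0≤Wind v)) (solve 2 (λ a b → (a :+ b) :- a := b) ≈-refl _ _))
    ... | no ¬free with outside? v
    ... | yes out = ≤-diff (+-nonNeg 0≤Wθ (0≤μH v∈L)) (≈-trans
            (+-cong (+-cong ≈-refl (+-cong ≈-refl (*-cong ≈-refl (ind-yes {v} out)))) ≈-refl)
            (solve 3 (λ a b c → a :+ (b :+ c) :- c := a :+ b) ≈-refl (W * θ) (μ v * H v) (W * μ v)))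
    ... | no ∣y∣≱n with y ℤ.≟ 0ℤ
    ... | no y≢0 = contradiction (ℕ.≰⇒> ∣y∣≱n , λ y≡0 → contradiction y≡0 y≢0) ¬free
    ... | yes refl = ≤-diff 0≤Wθ (≈-trans
            (+-cong (+-cong ≈-refl (+-cong (*-cong ≈-refl (*-cong (+-cong ≈-refl (ι² x)) ≈-refl))
                                           (*-cong ≈-refl (ind-no {v} ∣y∣≱n))))
                    (-‿cong (*-cong (*-cong (+-cong ≈-refl (*-cong X≈ X≈)) ≈-refl) ≈-refl)))
            (solve 5 (λ t w m n x → t :+ (m :* ((n :+ x :* x) :* (n :- nat 0)) :+ w :* nat 0) :- (n :+ x :* x) :* n :* m := t)
              ≈-refl (W * θ) W (μ v) N (abs x)))
      where
      ∣x∣≡width : ∣ x ∣ ≡ width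
      ∣x∣≡width = ℕ.≤-antisym (proj₁ (∈-box⁻ width n v∈L))
        (ℕ.≮⇒≥ λ lt → ¬free (n≥1 , λ _ → lt))
      X≈ : X ≈ abs x
      X≈ = fromℕ-cong (≡.sym ∣x∣≡width)

    summed : W ≤ ∣L∣ * (W * θ) + (N * N + W * out μ)
    summed = ≤-respˡ-≈ (≈-trans (≈-trans (Σ-cong L λ _ → *-cong ≈-refl (≈-sym (*-identityʳ _)))
        (Σ-*ˡ W _ L)) (≈-trans (*-cong ≈-refl total) (*-identityʳ W)))
      (≤-trans (Σ-mono-≤ L pointwise) (≤-trans
        (≤-reflexive (≈-trans (Σ-+ _ _ L) (+-cong (Σ-const (W * θ) L) (≈-trans (Σ-+ _ _ L)
          (+-cong ≈-refl (≈-trans (Σ-*ˡ W ind L) (*-cong ≈-refl (≈-sym (Σ-filter outside? μ L)))))))))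
        (+-monoʳ-≤ _ (+-mono-≤ H≤ ≤-refl))))

  N≤κ² : N ≤ fromℕ K * fromℕ K
  N≤κ² = ≤-respʳ-≈ (fromℕ-* K K) (fromℕ-mono-≤ n≤K²)

  QN²≤W : Q * (N * N) ≤ W
  QN²≤W = ≤-respʳ-≈ (*-cong (+-cong ≈-refl (*-cong (≈-sym (fromℕ-* q K)) (≈-sym (fromℕ-* q K)))) ≈-refl)
    (≤-diff
      (*-nonNeg (0≤fromℕ n) (+-nonNeg (0≤fromℕ n) (*-nonNeg (0≤fromℕ q) (+-nonNeg
        (*-nonNeg (≤⇒0≤- 1≤Q) (0≤x*x (fromℕ K))) (≤⇒0≤- N≤κ²)))))
      (solve 3 (λ q n κ → (n :+ (q :* κ) :* (q :* κ)) :* n :- q :* (n :* n)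
        := n :* (n :+ q :* ((q :- nat 1) :* (κ :* κ) :+ (κ :* κ :- n)))) ≈-refl Q N (fromℕ K)))
    where
    1≤Q : fromℕ 1 ≤ Q
    1≤Q = fromℕ-mono-≤ q≥1

  -- Divided by `W`, `summed` says that the mass not at the tips is at most ∣L∣ θ + N² / W. Both
  -- terms are at most 1/q, and 2/q ≤ 1 - p.
  exhausted⇒≤out : ∀ {μ} → (∀ v → 0# ≤ μ v) → ⟨ μ , one ⟩ ≈ 1# → ⟨ μ , H ⟩ ≤ N * N → Exhausted μ →
               ∀ {p} → fromℕ 2 ≤ Q * (1# - p) → p ≤ out μ
  exhausted⇒≤out {μ} 0≤μ total H≤ exhausted {p} 2≤Q[1-p] = *-cancelˡ-≤ 0<Q (*-cancelˡ-≤ 0<W (≤-diff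
    (+-nonNeg (+-nonNeg (*-nonNeg (proj₁ 0<Q) (≤⇒0≤- (summed 0≤μ total H≤ exhausted)))
      (≤⇒0≤- QN²≤W)) (*-nonNeg (proj₁ 0<W) (≤⇒0≤- 2≤Q[1-p])))
    -- The solver knows neither `θ-spec` nor `1# ≈ fromℕ 1`. The subtracted bracket carries both as
    -- correction terms, which the next step shows to be zero.
    (≈-trans (solve 8 (λ w q o p x l m s →
        w :* (q :* x) :- w :* (q :* p) :=
        (q :* (l :* (w :* m) :+ (s :+ w :* x) :- w) :+ (w :- q :* s)) :+ w :* (q :* (o :- p) :- nat 2)
          :- (w :* (m :* (q :* l) :- nat 1) :+ w :* q :* (o :- nat 1))) ≈-refl W Q 1# p (out μ) ∣L∣ θ (N * N))
      (≈-trans (+-cong ≈-refl (-‿cong (+-cong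
          (*-cong ≈-refl (≈-trans (+-cong (≈-trans θ-spec (≈-sym (+-identityʳ 1#))) ≈-refl) (-‿inverseʳ _)))
          (*-cong ≈-refl (≈-trans (+-cong (≈-sym (+-identityʳ 1#)) ≈-refl) (-‿inverseʳ _))))))
        (solve 3 (λ a w q → a :- (w :* nat 0 :+ w :* q :* nat 0) := a) ≈-refl _ W Q)))))

  -- `fuel` bounds the moves still possible: each raises the pairing with `squares` by at least `θ`,
  -- and that pairing never exceeds `F`. The extra `θ` on the left makes `fuel = 0` contradictory.
  record Invariant (fuel : ℕ) (μ : MassDistribution) : Set where
    field
      total   : ⟨ mass μ , one ⟩ ≈ 1#
      H≤      : ⟨ mass μ , H ⟩ ≤ N * N
      squares≥ : F + θ ≤ ⟨ mass μ , squares ⟩ + fromℕ fuel * θ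
  open Invariant

  squares≤ : ∀ {fuel μ} → Invariant fuel μ → ⟨ mass μ , squares ⟩ ≤ F
  squares≤ {μ = μ} inv = ≤-trans
    (Σ-mono-≤ L λ {v} v∈L → *-monoˡ-≤ (nonNeg μ v) (≤-respʳ-≈ (≈-sym (*-identityʳ F)) (squares≤F {v} v∈L)))
    (≤-reflexive (≈-trans
      (Σ-cong L λ {v} _ → solve 3 (λ m f o → m :* (f :* o) := f :* (m :* o)) ≈-refl (mass μ v) F 1#)
      (≈-trans (Σ-*ˡ F _ L) (≈-trans (*-cong ≈-refl (total inv)) (*-identityʳ F)))))

  Invariant-topple : ∀ {fuel μ v} → Invariant (suc fuel) μ → v ∈ L → Free v → θ ≤ mass μ v → ∀ 0<m m≤μv →
                     Invariant fuel (topple μ v (mass μ v) 0<m m≤μv)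
  Invariant-topple {fuel} {μ} {v} inv v∈L free θ≤m 0<m _ = record
    { total   = ≈-trans (⟨toppled⟩ int (mass μ) m one) (≈-trans
        (+-cong (total inv) (≈-trans (*-cong ≈-refl (Δ-const 1# v)) (zeroʳ m))) (+-identityʳ 1#))
    ; H≤      = ≤-respˡ-≈ (≈-sym (⟨toppled⟩ int (mass μ) m H)) (≤-respʳ-≈ (+-identityʳ _)
        (+-mono-≤ (H≤ inv) (≤-respʳ-≈ (zeroʳ m) (*-monoˡ-≤ (proj₁ 0<m) (ΔH≤0 v)))))
    ; squares≥ = ≤-trans (squares≥ inv) (≤-respʳ-≈ (+-cong (≈-sym (≈-trans (⟨toppled⟩ int (mass μ) m squares)
          (+-cong ≈-refl (≈-trans (*-cong ≈-refl (≈-trans (Δ-squares v) (+-identityʳ 1#))) (*-identityʳ m))))) ≈-refl)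
        (≤-diff (≤⇒0≤- θ≤m) (≈-trans
          (solve 5 (λ s m f t o → (s :+ m) :+ f :* t :- (s :+ (o :+ f) :* t) := (m :- o :* t)) ≈-refl
            ⟨ mass μ , squares ⟩ m (fromℕ fuel) θ 1#)
          (+-cong ≈-refl (-‿cong (*-identityˡ θ))))))
    }
    where
    m = mass μ v
    int : Interior v
    int = Free⇒interior {v} v∈L free

  Heavy : (ℤ × ℤ → Carrier) → Set
  Heavy μ = ∃[ v ] v ∈ L × Free v × θ ≤ μ v

  heavy-or-exhausted : ∀ μ → Heavy μ ⊎ Exhausted μ
  heavy-or-exhausted μ = decide (any? heavy? L)
    where
    heavy? : Decidable (λ v → Free v × θ ≤ μ v)
    heavy? v = free? v ×-dec (θ ≤? μ v)
    decide : Dec (Any (λ v → Free v × θ ≤ μ v) L) → Heavy μ ⊎ Exhausted μ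
    decide (yes any) = inj₁ (find any)
    decide (no ¬any) = inj₂ λ v∈L free → ≰⇒≥ λ θ≤m → ¬any (lose v∈L (free , θ≤m))

  ¬Invariant-0 : ∀ {μ} → ¬ Invariant 0 μ
  ¬Invariant-0 {μ} inv = <⇒≱ 0<θ (≤-diff
    (≤⇒0≤- (≤-trans (squares≥ inv) (≤-trans
      (≤-reflexive (solve 2 (λ s t → s :+ nat 0 :* t := s) ≈-refl ⟨ mass μ , squares ⟩ θ)) (squares≤ inv))))
    (solve 2 (λ f t → nat 0 :- t := f :- (f :+ t)) ≈-refl F θ))

  Transported : Carrier → ℕ → MassDistribution → Set
  Transported p fuel μ = ∃[ j ] ∃[ ν ] j ℕ.≤ fuel × μ ⟶[ j ] ν × p ≤ out (mass ν)

  transport : ∀ {p} → fromℕ 2 ≤ Q * (1# - p) → ∀ fuel {μ} → Invariant fuel μ → Transported p fuel μ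
  transport {p} 2≤Q[1-p] fuel {μ} inv = continue fuel inv (heavy-or-exhausted (mass μ))
    where
    prepend : ∀ {fuel μ} v m 0<m m≤μv → Transported p fuel (topple μ v m 0<m m≤μv) → Transported p (suc fuel) μ
    prepend v m 0<m m≤μv (j , ν , j≤ , steps , p≤) = suc j , ν , s≤s j≤ , move v m 0<m m≤μv steps , p≤

    continue : ∀ fuel {μ} → Invariant fuel μ → Heavy (mass μ) ⊎ Exhausted (mass μ) → Transported p fuel μ
    continue _ {μ} inv (inj₂ exhausted) = 0 , μ , z≤n , done ,
      exhausted⇒≤out (nonNeg μ) (total inv) (H≤ inv) exhausted 2≤Q[1-p]
    continue zero inv (inj₁ _) = contradiction inv ¬Invariant-0
    continue (suc fuel) {μ} inv (inj₁ (v , v∈L , free , θ≤m)) =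
      prepend v (mass μ v) 0<m ≤-refl (continue fuel inv′ (heavy-or-exhausted _))
      where
      0<m : 0# < mass μ v
      0<m = <-≤-trans 0<θ θ≤m
      inv′ : Invariant fuel (topple μ v (mass μ v) 0<m ≤-refl)
      inv′ = Invariant-topple {v = v} inv v∈L free θ≤m 0<m ≤-refl

  -- This is F / θ, a natural number because the inverse of `θ` is q times the size of the box, plus
  -- one for the extra `θ` in `squares≥`.
  steps-bound : ℕ
  steps-bound = suc (q ℕ.* length L ℕ.* (width ℕ.* width ℕ.+ n ℕ.* n))

  start : Invariant steps-bound (unitMass o)
  start = record
    { total   = Σ-δ-∈ one (box-unique width n) o∈L
    ; H≤      = ≤-reflexive (≈-trans (Σ-δ-∈ H (box-unique width n) o∈L)
        (solve 1 (λ n → (n :+ nat 0 :* nat 0) :* (n :- nat 0) := n :* n) ≈-refl N))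
    ; squares≥ = ≤-reflexive (≈-sym (≈-trans
        (+-cong (Σ-δ-∈ squares (box-unique width n) o∈L) (*-cong (+-cong ≈-refl
          (≈-trans (fromℕ-* (q ℕ.* length L) _) (*-cong (fromℕ-* q (length L))
            (≈-trans (fromℕ-+ (width ℕ.* width) _) (+-cong (fromℕ-* width width) (fromℕ-* n n)))))) ≈-refl))
        (≈-trans (solve 5 (λ o q l f t → (nat 0 :* nat 0 :+ nat 0 :* nat 0) :+ (o :+ q :* l :* f) :* t
                   := f :* (t :* (q :* l)) :+ o :* t) ≈-refl 1# Q ∣L∣ F θ)
          (+-cong (≈-trans (*-cong ≈-refl θ-spec) (*-identityʳ F)) (*-identityˡ θ)))))
    }
    where
    o∈L : o ∈ L
    o∈L = ∈-box⁺ {width} {n} z≤n z≤n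

  topplings-upper : ∀ {p} → fromℕ 2 ≤ Q * (1# - p) →
    ∃[ j ] ∃[ ν ] j ℕ.≤ steps-bound × unitMass o ⟶[ j ] ν × MassOutside≥ (Graph.Ball ℂ₂ o n) p ν
  topplings-upper {p} 2≤Q[1-p] = conclude (transport 2≤Q[1-p] steps-bound start)
    where
    outside⇒∉Ball : ∀ {v} → Outside v → ¬ Graph.Ball ℂ₂ o n v
    outside⇒∉Ball {x , y} n≤∣y∣ ball = ℕ.<⇒≱ (Ball⇒norm< (x , y) ball) (ℕ.≤-trans n≤∣y∣ (ℕ.m≤n+m ∣ y ∣ ∣ x ∣))

    conclude : Transported p steps-bound (unitMass o) → _
    conclude (j , ν , j≤ , steps , p≤out) = j , ν , j≤ , steps , λ r r<p →
      filter outside? L , Unique-filter⁺ outside? (box-unique width n) ,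
      All.tabulate (λ {v} v∈ → outside⇒∉Ball {v} (proj₂ (∈-filter⁻ outside? {xs = L} v∈))) ,
      <-≤-trans r<p p≤out

  length-L : length L ≡ (1 ℕ.+ 2 ℕ.* width) ℕ.* (1 ℕ.+ 2 ℕ.* n)
  length-L = ≡.trans (length-cartesianProduct (interval width) (interval n))
    (≡.cong₂ ℕ._*_ (length-interval width) (length-interval n))

  -- 82 = 1 + 3 · 3 · 9: the successor, the two sides 1 + 2a ≤ 3a of the box, and 9 = 8 + 1 from K²
  -- ≤ 8n in `F≤`.
  steps-bound≤ : K ℕ.* K ℕ.≤ 8 ℕ.* n → steps-bound ℕ.≤ 82 ℕ.* (q ℕ.* q ℕ.* (q ℕ.* q)) ℕ.* (K ℕ.* (n ℕ.* n ℕ.* n))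
  steps-bound≤ K²≤8n = begin
    suc (q ℕ.* length L ℕ.* (width ℕ.* width ℕ.+ n ℕ.* n))
      ≡⟨ ≡.cong (λ l → suc (q ℕ.* l ℕ.* (width ℕ.* width ℕ.+ n ℕ.* n))) length-L ⟩
    suc (q ℕ.* ((1 ℕ.+ 2 ℕ.* width) ℕ.* (1 ℕ.+ 2 ℕ.* n)) ℕ.* (width ℕ.* width ℕ.+ n ℕ.* n))
      ≤⟨ ℕ.+-mono-≤ 1≤M (ℕ.*-mono-≤ (ℕ.*-monoʳ-≤ q (ℕ.*-mono-≤
           (ℕ.+-monoˡ-≤ (2 ℕ.* width) (ℕ.*-mono-≤ q≥1 K≥1)) (ℕ.+-monoˡ-≤ (2 ℕ.* n) n≥1))) F≤) ⟩
    M ℕ.+ q ℕ.* ((width ℕ.+ 2 ℕ.* width) ℕ.* (n ℕ.+ 2 ℕ.* n)) ℕ.* (9 ℕ.* (q ℕ.* q ℕ.* (n ℕ.* n)))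
      ≡⟨ solveℕ 3 (λ q K n → let M = q ⊗ q ⊗ (q ⊗ q) ⊗ (K ⊗ (n ⊗ n ⊗ n)) in
           M ⊕ q ⊗ ((q ⊗ K ⊕ conℕ 2 ⊗ (q ⊗ K)) ⊗ (n ⊕ conℕ 2 ⊗ n)) ⊗ (conℕ 9 ⊗ (q ⊗ q ⊗ (n ⊗ n)))
           ⊜ conℕ 82 ⊗ (q ⊗ q ⊗ (q ⊗ q)) ⊗ (K ⊗ (n ⊗ n ⊗ n))) refl q K n ⟩
    82 ℕ.* (q ℕ.* q ℕ.* (q ℕ.* q)) ℕ.* (K ℕ.* (n ℕ.* n ℕ.* n)) ∎
    where
    open ℕ.≤-Reasoning
    M : ℕ
    M = q ℕ.* q ℕ.* (q ℕ.* q) ℕ.* (K ℕ.* (n ℕ.* n ℕ.* n))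
    1≤M : 1 ℕ.≤ M
    1≤M = ℕ.*-mono-≤ (ℕ.*-mono-≤ (ℕ.*-mono-≤ q≥1 q≥1) (ℕ.*-mono-≤ q≥1 q≥1))
            (ℕ.*-mono-≤ K≥1 (ℕ.*-mono-≤ (ℕ.*-mono-≤ n≥1 n≥1) n≥1))
    n≤n² : n ℕ.≤ n ℕ.* n
    n≤n² = ℕ.≤-trans (ℕ.≤-reflexive (≡.sym (ℕ.*-identityʳ n))) (ℕ.*-monoʳ-≤ n n≥1)
    F≤ : width ℕ.* width ℕ.+ n ℕ.* n ℕ.≤ 9 ℕ.* (q ℕ.* q ℕ.* (n ℕ.* n))
    F≤ = begin
      width ℕ.* width ℕ.+ n ℕ.* n
        ≡⟨ solveℕ 3 (λ q K n → q ⊗ K ⊗ (q ⊗ K) ⊕ n ⊗ n ⊜ q ⊗ q ⊗ (K ⊗ K) ⊕ conℕ 1 ⊗ (n ⊗ n)) refl q K n ⟩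
      q ℕ.* q ℕ.* (K ℕ.* K) ℕ.+ 1 ℕ.* (n ℕ.* n)
        ≤⟨ ℕ.+-mono-≤ (ℕ.*-monoʳ-≤ (q ℕ.* q) (ℕ.≤-trans K²≤8n (ℕ.*-monoʳ-≤ 8 n≤n²)))
                      (ℕ.*-monoˡ-≤ (n ℕ.* n) (ℕ.*-mono-≤ q≥1 q≥1)) ⟩
      q ℕ.* q ℕ.* (8 ℕ.* (n ℕ.* n)) ℕ.+ q ℕ.* q ℕ.* (n ℕ.* n)
        ≡⟨ solveℕ 2 (λ q n → q ⊗ q ⊗ (conℕ 8 ⊗ (n ⊗ n)) ⊕ q ⊗ q ⊗ (n ⊗ n) ⊜ conℕ 9 ⊗ (q ⊗ q ⊗ (n ⊗ n))) refl q n ⟩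
      9 ℕ.* (q ℕ.* q ℕ.* (n ℕ.* n)) ∎

-- Existence of least elements

minimum : ∀ {P : Pred ℕ 0ℓ} → Decidable P → ∃ P → ∃[ m ] IsMinimum P [ m ]
minimum {P} P? (b , Pb) = below (search (suc b))
  where
  search : ∀ n → (∃[ m ] IsMinimum P [ m ]) ⊎ (∀ j → j ℕ.< n → ¬ P j)
  search zero = inj₂ λ _ ()
  search (suc n) with search n
  ... | inj₁ m = inj₁ m
  ... | inj₂ none with P? n
  ... | yes Pn = inj₁ (n , Pn , λ j Pj → ℕ.≮⇒≥ λ j<n → none j j<n Pj)
  ... | no ¬Pn = inj₂ λ j j<1+n Pj → none j
                   (ℕ.≤∧≢⇒< (ℕ.≤-pred j<1+n) λ { refl → ¬Pn Pj }) Pj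
  below : (∃[ m ] IsMinimum P [ m ]) ⊎ (∀ j → j ℕ.< suc b → ¬ P j) → ∃[ m ] IsMinimum P [ m ]
  below (inj₁ m)    = m
  below (inj₂ none) = contradiction Pb (none b ℕ.≤-refl)

-- Comparing the power 7/2 with polynomials in n and K

module HalfPowers (ℝ : Reals) (n K : ℕ) (K≥1 : 1 ℕ.≤ K) (K²≤8n : K ℕ.* K ℕ.≤ 8 ℕ.* n) where
  open Reals ℝ
  open OrderedField ℝ

  N κ : Carrier
  N = fromℕ n
  κ = fromℕ K

  0<κ : 0# < κ
  0<κ = 0<fromℕ K≥1

  κ²≤8N : κ * κ ≤ fromℕ 8 * N
  κ²≤8N = ≤-respˡ-≈ (fromℕ-* K K) (≤-respʳ-≈ (fromℕ-* 8 n) (fromℕ-mono-≤ K²≤8n))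

  private
    N⁶ N⁷ : Carrier
    N⁶ = N * N * N * (N * N * N)
    N⁷ = N⁶ * N

    0≤N⁶ : 0# ≤ N⁶
    0≤N⁶ = 0≤x*x (N * N * N)

    ^7≈ : N ^ 7 ≈ N⁷
    ^7≈ = solve 1 (λ n → n :^ 7 := n :* n :* n :* (n :* n :* n) :* n) ≈-refl N

  -- After squaring this is κ² N⁷ ≤ 9 N⁸, a consequence of κ² ≤ 8 N; 3 is the least natural number
  -- whose square is at least 8.
  [7/2]-upper : κ * n ^[7/2] ≤ fromℕ 3 * (N * N * (N * N))
  [7/2]-upper = ≤-respʳ-≈ (clear (fromℕ 3 * (N * N * (N * N)))) (*-monoˡ-≤ (proj₁ 0<κ)
    (√-≤ (^-nonNeg (0≤fromℕ n) 7) (*-nonNeg (*-nonNeg (0≤fromℕ 3) (0≤x*x (N * N))) (proj₁ (⁻¹-pos 0<κ)))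
      (*-cancelˡ-≤ (*-pos 0<κ 0<κ) (≤-respˡ-≈ (*-cong ≈-refl (≈-sym ^7≈)) (≤-respʳ-≈ (≈-sym square)
        (≤-diff (+-nonNeg (*-nonNeg (*-nonNeg 0≤N⁶ (0≤fromℕ n)) (≤⇒0≤- κ²≤8N)) (*-nonNeg (*-nonNeg 0≤N⁶ (0≤fromℕ n)) (0≤fromℕ n)))
          (solve 2 (λ n κ → let n⁷ = n :* n :* n :* (n :* n :* n) :* n in
             (nat 3 :* (n :* n :* (n :* n))) :* (nat 3 :* (n :* n :* (n :* n))) :- κ :* κ :* n⁷
             := n⁷ :* (nat 8 :* n :- κ :* κ) :+ n⁷ :* n) ≈-refl N κ)))))))
    where
    clear : ∀ a → κ * (a * κ ⁻¹) ≈ a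
    clear a = ≈-trans (solve 3 (λ k a i → k :* (a :* i) := (i :* k) :* a) ≈-refl κ a (κ ⁻¹))
      (≈-trans (*-cong (⁻¹-inverseˡ 0<κ) ≈-refl) (*-identityˡ a))
    square : ∀ {a} → κ * κ * ((a * κ ⁻¹) * (a * κ ⁻¹)) ≈ a * a
    square {a} = ≈-trans (solve 3 (λ k a i → k :* k :* ((a :* i) :* (a :* i)) := (k :* (a :* i)) :* (k :* (a :* i)))
      ≈-refl κ a (κ ⁻¹)) (*-cong (clear a) (clear a))

  -- `≤-√` asks for a number whose square is at most N⁷, and κ N³ / 3 is one because κ² ≤ 8 N.
  [7/2]-lower : κ * (N * N * N) ≤ fromℕ 3 * n ^[7/2]
  [7/2]-lower = ≤-respˡ-≈ (clear (κ * (N * N * N))) (*-monoˡ-≤ (0≤fromℕ 3)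
    (≤-√ (^-nonNeg (0≤fromℕ n) 7) (*-cancelˡ-≤ (*-pos 0<3 0<3)
      (≤-respˡ-≈ (≈-sym square) (≤-respʳ-≈ (*-cong ≈-refl (≈-sym ^7≈))
        (≤-diff (+-nonNeg (*-nonNeg 0≤N⁶ (≤⇒0≤- κ²≤8N)) (*-nonNeg 0≤N⁶ (0≤fromℕ n)))
          (solve 2 (λ n κ → let n⁶ = n :* n :* n :* (n :* n :* n) in
             nat 3 :* nat 3 :* (n⁶ :* n) :- (κ :* (n :* n :* n)) :* (κ :* (n :* n :* n))
             := n⁶ :* (nat 8 :* n :- κ :* κ) :+ n⁶ :* n) ≈-refl N κ)))))))
    where
    0<3 : 0# < fromℕ 3
    0<3 = 0<fromℕ-suc 2
    clear : ∀ a → fromℕ 3 * (a * fromℕ 3 ⁻¹) ≈ a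
    clear a = ≈-trans (solve 3 (λ k a i → k :* (a :* i) := (i :* k) :* a) ≈-refl (fromℕ 3) a (fromℕ 3 ⁻¹))
      (≈-trans (*-cong (⁻¹-inverseˡ 0<3) ≈-refl) (*-identityˡ a))
    square : ∀ {a} → fromℕ 3 * fromℕ 3 * ((a * fromℕ 3 ⁻¹) * (a * fromℕ 3 ⁻¹)) ≈ a * a
    square {a} = ≈-trans (solve 3 (λ k a i → k :* k :* ((a :* i) :* (a :* i)) := (k :* (a :* i)) :* (k :* (a :* i)))
      ≈-refl (fromℕ 3) a (fromℕ 3 ⁻¹)) (*-cong (clear a) (clear a))

-- Constants and the two-sided estimate

module Estimates (ℝ : Reals) where
  open Reals ℝ
  open OrderedField ℝ
  open Toppling ℝ ℂ₂

  module Scale (p : Carrier) (p<1 : p < 1#) where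

    0<1-p : 0# < 1# - p
    0<1-p = ≤⇒0≤- (proj₁ p<1) , λ 0≈1-p → proj₂ p<1 (≈-trans
      (≈-trans (≈-sym (+-identityʳ p)) (+-cong ≈-refl 0≈1-p)) (solve 2 (λ p o → p :+ (o :- p) := o) ≈-refl p 1#))

    scale : ∃[ q ] 1 ℕ.≤ q × fromℕ 2 ≤ fromℕ q * (1# - p)
    scale = from (archimedean (fromℕ 2 * (1# - p) ⁻¹))
      where
      from : ∃[ m ] fromℕ 2 * (1# - p) ⁻¹ ≤ fromℕ m → ∃[ q ] 1 ℕ.≤ q × fromℕ 2 ≤ fromℕ q * (1# - p)
      from (m , x≤m) = suc m , s≤s z≤n ,
        ≤-respˡ-≈ (≈-trans (*-assoc _ _ _) (≈-trans (*-cong ≈-refl (⁻¹-inverseˡ 0<1-p)) (*-identityʳ _)))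
          (*-monoʳ-≤ (proj₁ 0<1-p) (≤-trans x≤m (fromℕ-mono-≤ (ℕ.n≤1+n m))))

  module Bounds
    (p : Carrier) (0<p : 0# < p) (q : ℕ) (q≥1 : 1 ℕ.≤ q) (2≤Q[1-p] : fromℕ 2 ≤ fromℕ q * (1# - p)) where
    Reaches : ℕ → ℕ → Set
    Reaches n j = ∃[ μ ] unitMass o ⟶[ j ] μ × MassOutside≥ (Graph.Ball ℂ₂ o n) p μ

    -- `MassOutside≥` yields a finite list only for a threshold strictly below `p`. Half of `p` is
    -- such a threshold and costs only a constant factor.
    h : Carrier
    h = p * fromℕ 2 ⁻¹

    2h≈p : fromℕ 2 * h ≈ p
    2h≈p = ≈-trans (solve 3 (λ t p i → t :* (p :* i) := p :* (i :* t)) ≈-refl (fromℕ 2) p (fromℕ 2 ⁻¹))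
      (≈-trans (*-cong ≈-refl (⁻¹-inverseˡ (0<fromℕ-suc 1))) (*-identityʳ p))

    0<h : 0# < h
    0<h = *-pos 0<p (⁻¹-pos (0<fromℕ-suc 1))

    p-h≈h : p - h ≈ h
    p-h≈h = ≈-trans (+-cong (≈-sym 2h≈p) ≈-refl) (solve 1 (λ h → nat 2 :* h :- h := h) ≈-refl h)

    h<p : h < p
    h<p = ≤-diff (proj₁ 0<h) p-h≈h , λ h≈p → proj₂ 0<h
      (≈-trans (≈-sym (-‿inverseʳ h)) (≈-trans (+-cong h≈p ≈-refl) p-h≈h))

    -- 96 = 32 · 3 joins `topplings-lower` with `[7/2]-upper`, and 82 q⁴ · 3 joins `steps-bound≤`
    -- with `[7/2]-lower`. The summand `c` in `C` makes `c≤C` immediate.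
    c C : Carrier
    c = h * h * fromℕ 96 ⁻¹
    C = fromℕ (82 ℕ.* (q ℕ.* q ℕ.* (q ℕ.* q))) * fromℕ 3 + c

    0<c : 0# < c
    0<c = *-pos (*-pos 0<h 0<h) (⁻¹-pos (0<fromℕ-suc 95))

    c≤C : c ≤ C
    c≤C = ≤-diff (*-nonNeg (0≤fromℕ (82 ℕ.* (q ℕ.* q ℕ.* (q ℕ.* q)))) (0≤fromℕ 3))
      (solve 2 (λ a c → (a :+ c) :- c := a) ≈-refl _ c)

    Estimate : ℕ → Set
    Estimate n = ∃[ m ] IsN p (Graph.Ball ℂ₂ o n) (unitMass o) [ m ] × c * n ^[7/2] ≤ fromℕ m × fromℕ m ≤ C * n ^[7/2]

    module _ (n : ℕ) (n≥1 : 1 ℕ.≤ n) (K : ℕ) (2n≤K² : 2 ℕ.* n ℕ.≤ K ℕ.* K) (K²≤8n : K ℕ.* K ℕ.≤ 8 ℕ.* n) where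

      K≥1 : 1 ℕ.≤ K
      K≥1 = positive K (ℕ.≤-trans (ℕ.≤-trans n≥1 (ℕ.m≤n*m n 2)) 2n≤K²)
        where
        positive : ∀ K → 1 ℕ.≤ K ℕ.* K → 1 ℕ.≤ K
        positive (suc _) _ = s≤s z≤n

      open HalfPowers ℝ n K K≥1 K²≤8n
      module Lower = CombKernel ℝ n K K≥1 n≥1 2n≤K²
      module Upper = CombTransport ℝ n K q K≥1 n≥1 q≥1 (ℕ.≤-trans (ℕ.m≤n*m n 2) 2n≤K²)

      S : Carrier
      S = n ^[7/2]

      0≤S : 0# ≤ S
      0≤S = ≤-√ (^-nonNeg (0≤fromℕ n) 7) (≤-respˡ-≈ (≈-sym (zeroˡ 0#)) (^-nonNeg (0≤fromℕ n) 7))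

      reaches : ∃[ j ] j ℕ.≤ Upper.steps-bound × Reaches n j
      reaches = reorder (Upper.topplings-upper 2≤Q[1-p])
        where
        reorder : _ → ∃[ j ] j ℕ.≤ Upper.steps-bound × Reaches n j
        reorder (j , ν , j≤ , steps , outside) = j , j≤ , ν , steps , outside

      lower : ∀ {j} → Reaches n j → c * S ≤ fromℕ j
      lower {j} (ν , steps , outside) = *-cancelˡ-≤ (*-pos (0<fromℕ-suc 95) 0<κ) (≤-trans
        (≤-respˡ-≈ scaled (*-monoˡ-≤ (*-nonNeg (proj₁ 0<h) (proj₁ 0<h)) [7/2]-upper))
        (≤-diff (*-nonNeg (0≤fromℕ 3) (≤⇒0≤- (bound (outside h h<p))))
          (solve 4 (λ κ j h m → nat 96 :* κ :* j :- h :* (nat 3 :* m) := nat 3 :* (nat 32 :* κ :* j :- h :* m))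
            ≈-refl κ (fromℕ j) (h * h) (N * N * (N * N)))))
        where
        bound : _ → h * h * (N * N * (N * N)) ≤ fromℕ 32 * κ * fromℕ j
        bound (vs , unique , vs∉Ball , h<Σ) = Lower.topplings-lower (proj₁ 0<h) steps unique vs∉Ball (proj₁ h<Σ)

        scaled : h * h * (κ * S) ≈ fromℕ 96 * κ * (c * S)
        scaled = ≈-sym (≈-trans (solve 5 (λ a κ h i s → a :* κ :* (h :* i :* s) := (i :* a) :* (h :* (κ :* s)))
          ≈-refl (fromℕ 96) κ (h * h) (fromℕ 96 ⁻¹) S)
          (≈-trans (*-cong (⁻¹-inverseˡ (0<fromℕ-suc 95)) ≈-refl) (*-identityˡ _)))

      upper : ∀ {j} → j ℕ.≤ Upper.steps-bound → fromℕ j ≤ C * S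
      upper {j} j≤ = ≤-trans (fromℕ-mono-≤ (ℕ.≤-trans j≤ (Upper.steps-bound≤ K²≤8n)))
        (≤-trans (≤-reflexive (≈-trans (fromℕ-* (82 ℕ.* (q ℕ.* q ℕ.* (q ℕ.* q))) _) (*-cong ≈-refl
            (≈-trans (fromℕ-* K _) (*-cong ≈-refl (≈-trans (fromℕ-* (n ℕ.* n) n) (*-cong (fromℕ-* n n) ≈-refl)))))))
          (≤-trans (*-monoˡ-≤ (0≤fromℕ (82 ℕ.* (q ℕ.* q ℕ.* (q ℕ.* q)))) [7/2]-lower)
            (≤-diff (*-nonNeg (proj₁ 0<c) 0≤S)
              (solve 4 (λ a t c s → (a :* t :+ c) :* s :- a :* (t :* s) := c :* s) ≈-refl _ (fromℕ 3) c S))))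

      estimate : Estimate n
      estimate = conclude reaches (minimum (λ _ → excludedMiddle) (proj₁ reaches , proj₂ (proj₂ reaches)))
        where
        conclude : (∃[ j ] j ℕ.≤ Upper.steps-bound × Reaches n j) → (∃[ m ] IsMinimum (Reaches n) [ m ]) → Estimate n
        conclude (j , j≤ , reach) (m , reach-m , least) = m , (reach-m , least) ,
          lower reach-m , upper (ℕ.≤-trans (least j reach) j≤)

    estimates : ∀ n → 1 ℕ.≤ n → Estimate n
    -- The argument is the predecessor of 2n, written so that its successor is `2 ℕ.* n` by
    -- computation.
    estimates n@(suc m) n≥1 = from (sqrt-approx (m ℕ.+ 1 ℕ.* n))
      where
      from : (∃[ K ] 2 ℕ.* n ℕ.≤ K ℕ.* K × K ℕ.* K ℕ.≤ 4 ℕ.* (2 ℕ.* n)) → Estimate n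
      from (K , 2n≤K² , K²≤4[2n]) = estimate n n≥1 K 2n≤K²
        (ℕ.≤-trans K²≤4[2n] (ℕ.≤-reflexive (≡.sym (ℕ.*-assoc 4 2 n))))

theorem1p4 : (ℝ : Reals) → let open Reals ℝ in let open Graph ℂ₂ in let open Toppling ℝ ℂ₂ in
    ∀ (p : Carrier) → 0# < p → p < 1# →
    ∃[ c ] ∃[ C ] ∃[ n₀ ] 0# < c × c ≤ C ×
    (∀ (n : ℕ) → n₀ ℕ.≤ n →
    ∃[ N ] IsN p (Ball o n) (unitMass o) [ N ] ×
    c * n ^[7/2] ≤ fromℕ N × fromℕ N ≤ C * n ^[7/2])
theorem1p4 ℝ p 0<p p<1 = c , C , 1 , 0<c , c≤C , estimates
  where
  open Estimates ℝ
  open Scale p p<1 using (scale)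
  open Bounds p 0<p (proj₁ scale) (proj₁ (proj₂ scale)) (proj₂ (proj₂ scale))
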